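{- Fix an integer $m\ge 2$ and let $C_{2m+1}$ be the cycle graph on $2m+1$ vertices. Then: (1) all groups $\mathrm{MH}_{k,l}(C_{2m+1})$ are torsion-free; (2) define $T:\mathbb Z\times\mathbb Z\to\mathbb Z$ by $T(k,l)=0$ if $k<0$ or $l<0$; $T(0,0)=2m+1$, $T(1,1)=4m+2$; and $T(k,l)=T(k-1,l-1)+2T(k-2,l-(m+1))$ for all other $(k,l)$ (i.e. $k,l\ge 0$ and $(k,l)\ne(0,0),(1,1)$). Then $\operatorname{rk}\mathrm{MH}_{k,l}(C_{2m+1})=T(k,l)$ for all $k,l$.
   Context: For a finite simple undirected connected graph $G$, $d$ denotes the shortest-path metric on $V(G)$. For a tuple of vertices $(x_0,\ldots,x_k)$ put $\ell(x_0,\ldots,x_k)=\sum_{i=0}^{k-1} d(x_i,x_{i+1})$. The magnitude chain complex has $\mathrm{MC}_{k,l}(G)$ equal to the free abelian group on the tuples $(x_0,\ldots,x_k)\in V(G)^{k+1}$ with $x_i\neq x_{i+1}$ for all $i$ and $\ell(x_0,\ldots,x_k)=l$, with differential $\partial=\sum_{1\le i\le k-1}(-1)^i\partial_i:\mathrm{MC}_{k,l}(G)\to \mathrm{MC}_{k-1,l}(G)$, where $\partial_i(x_0,\ldots,x_k)=(x_0,\ldots,\hat x_i,\ldots,x_k)$ if $\ell(x_0,\ldots,\hat x_i,\ldots,x_k)=\ell(x_0,\ldots,x_k)$ and $0$ otherwise. Magnitude homology is $\mathrm{MH}_{k,l}(G)=H_k(\mathrm{MC}_{*,l}(G))$ (integer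 coefficients). -}

module Defs where

open import Data.Nat using (ℕ; zero; suc; _+_; _*_; _∸_; _≤ᵇ_; _≡ᵇ_)
open import Data.Bool using (Bool; true; false; _∧_; _∨_; if_then_else_; not)
open import Data.Fin using (Fin; toℕ)
import Data.Fin as Fin
open import Data.List using (List; []; _∷_; map; concatMap; foldr; allFin)
open import Data.Bool.ListAction using (any)
open import Data.Vec using (Vec; []; _∷_; removeAt)
open import Data.Vec.Properties using (≡-dec)
open import Data.Integer using (ℤ; 0ℤ; 1ℤ; -_) renaming (_+_ to _+ℤ_; _*_ to _*ℤ_)
open import Data.Product using (Σ; _×_; ∃)
open import Relation.Nullary using (¬_; does)
open import Relation.Binary.PropositionalEquality using (_≡_; _≢_)

sumℤ : List ℤ → ℤ
sumℤ = foldr _+ℤ_ 0ℤ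

module Graph (n : ℕ) (adj : Fin n → Fin n → Bool) where

  within : ℕ → Fin n → Fin n → Bool
  within zero    x y = does (x Fin.≟ y)
  within (suc k) x y = within k x y ∨ any (λ z → within k x z ∧ adj z y) (allFin n)

  -- shortest-path distance: least k with within k x y (searching k = 0 .. n;
  -- in a connected graph on n vertices the distance is < n)
  dist : Fin n → Fin n → ℕ
  dist x y = search n 0
    where
    search : ℕ → ℕ → ℕ
    search zero    k = k
    search (suc f) k = if within k x y then k else search f (suc k)

  Tup : ℕ → Set
  Tup k = Vec (Fin n) (suc k)

  allVecs : (j : ℕ) → List (Vec (Fin n) j)
  allVecs zero    = [] ∷ []
  allVecs (suc j) = concatMap (λ v → map (λ x → x ∷ v) (allFin n)) (allVecs j)

  len : ∀ {j} → Vec (Fin n) j → ℕ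
  len []           = 0
  len (x ∷ [])     = 0
  len (x ∷ y ∷ xs) = dist x y + len (y ∷ xs)

  noRep : ∀ {j} → Vec (Fin n) j → Bool
  noRep []           = true
  noRep (x ∷ [])     = true
  noRep (x ∷ y ∷ xs) = not (does (x Fin.≟ y)) ∧ noRep (y ∷ xs)

  valid : (k l : ℕ) → Tup k → Bool
  valid k l x = noRep x ∧ (len x ≡ᵇ l)

  -- chains of degree k: integer-valued functions on (k+1)-tuples (finitely supported
  -- automatically since the set of tuples is finite)
  Chain : ℕ → Set
  Chain k = Tup k → ℤ

  InMC : (k l : ℕ) → Chain k → Set
  InMC k l c = ∀ x → valid k l x ≡ false → c x ≡ 0ℤ

  sign : ℕ → ℤ
  sign zero    = 1ℤ
  sign (suc i) = - sign i

  ∂coeff : (k : ℕ) → Tup (suc k) → Tup k → ℤ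
  ∂coeff k x y = sumℤ (map term (allFin (suc (suc k))))
    where
    term : Fin (suc (suc k)) → ℤ
    term i = if (1 ≤ᵇ toℕ i) ∧ (toℕ i ≤ᵇ k)
                ∧ does (≡-dec Fin._≟_ (removeAt x i) y)
                ∧ (len (removeAt x i) ≡ᵇ len x)
             then sign (toℕ i) else 0ℤ

  ∂ : (k : ℕ) → Chain (suc k) → Chain k
  ∂ k c y = sumℤ (map (λ x → c x *ℤ ∂coeff k x y) (allVecs (suc (suc k))))

  Cycle : (k l : ℕ) → Chain k → Set
  Cycle zero    l c = InMC zero l c
  Cycle (suc k) l c = InMC (suc k) l c × (∀ y → ∂ k c y ≡ 0ℤ)

  Boundary : (k l : ℕ) → Chain k → Set
  Boundary k l z = Σ (Chain (suc k)) λ c → InMC (suc k) l c × (∀ y → ∂ k c y ≡ z y)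

  TorsionFree : (k l : ℕ) → Set
  TorsionFree k l = ∀ (z : Chain k) → Cycle k l z → (a : ℤ) → a ≢ 0ℤ →
                    Boundary k l (λ x → a *ℤ z x) → Boundary k l z

  Independent : (k l r : ℕ) → (Fin r → Chain k) → Set
  Independent k l r zs =
    (∀ i → Cycle k l (zs i)) ×
    (∀ (a : Fin r → ℤ) →
       Boundary k l (λ x → sumℤ (map (λ i → a i *ℤ zs i x) (allFin r))) →
       ∀ i → a i ≡ 0ℤ)

  HasRank : (k l r : ℕ) → Set
  HasRank k l r = (∃ λ zs → Independent k l r zs) ×
                  ¬ (∃ λ zs → Independent k l (suc r) zs)

cycleAdj : (n : ℕ) → Fin n → Fin n → Bool
cycleAdj n i j =
  (suc (toℕ i) ≡ᵇ toℕ j) ∨ (suc (toℕ j) ≡ᵇ toℕ i)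
  ∨ ((toℕ i ≡ᵇ 0) ∧ (suc (toℕ j) ≡ᵇ n))
  ∨ ((toℕ j ≡ᵇ 0) ∧ (suc (toℕ i) ≡ᵇ n))

-- the recursion T(k,l), restricted to k,l ≥ 0 (T vanishes for negative arguments)
-- T(0,0)=2m+1, T(1,1)=4m+2, T(k,l)=T(k-1,l-1)+2T(k-2,l-(m+1)) otherwise.
T : (m : ℕ) → ℕ → ℕ → ℕ
T m zero          zero          = 2 * m + 1
T m zero          (suc l)       = 0                        -- T(-1,l)+2T(-2,·)
T m (suc zero)    zero          = 0                        -- T(0,-1)+2T(-1,·)
T m (suc zero)    (suc zero)    = 4 * m + 2
T m (suc zero)    (suc (suc l)) = T m zero (suc l)         -- + 2T(-1,·) = 0
T m (suc (suc k)) zero          = 0                        -- T(k+1,-1) + 2T(k,-(m+1))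
T m (suc (suc k)) (suc l)       =
  T m (suc k) l + 2 * (if suc m ≤ᵇ suc l then T m k (suc l ∸ suc m) else 0)

{-# OPTIONS --safe #-}

module Submission where

-- On C_{2m+1} a pair of distinct vertices is the same thing as a nonzero step a with |a| ≤ m, and a vertex can be
-- deleted from a tuple exactly when the two steps around it have the same direction and sizes adding up to at most m.
-- So the magnitude complex is a sum of 2m+1 copies of the reduced bar complex of ℤ[x,y]/(x^{m+1}, y^{m+1}, xy),
-- graded by total length.  Splitting a leading step a of size ≥ 2 into (±1, a ∓ 1) contracts this complex onto the
-- span of the words () , (±1), (1, m, w) up to sign, and (±1, b, w) with b in the opposite direction to ±1; there
-- the contraction is applied recursively to w and to (b, w) respectively.  What survives are the critical words,
-- in which no two neighbouring steps can be merged: they are cycles on the nose and form a basis of the homology,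
-- and splitting off their first steps gives the recursion for T.
-- All operators are given by their action on cochains (integer functions on words); the chain-level statements are
-- obtained by pairing.

-- Torsion-freeness and rank have one source. The homotopy is integral and the projection kills
-- boundaries, so a cycle bounds exactly when its projection `pr` vanishes; `pr` is linear with
-- integer values supported on the critical tuples. A nonzero factor can therefore be cancelled, and
-- homology embeds in the free group on those tuples. The number m + 1 comes from a defect of
-- splitting. The shortened step a ∓ 1 can be merged with slightly more than a itself: exactly with
-- the steps whose size and that of a add up to m + 1. All such pairs of one direction are collected
-- in (1, m). A step of size m merges with nothing, so the complex starts anew behind that pair;
-- behind a unit followed by a turn it continues with its direction prescribed. Oddness enters
-- through two bounds: two steps of size at most m stay below 2m + 1, and a run longer than m has a
-- complement of at most m. Hence distinct vertices have exactly one short direction. On cochains,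
-- prefixing a letter becomes partial application, so each operator is a recursion along a single
-- word and no formal sums of words occur.

open import Defs
open import Data.Bool using (Bool; true; false; not; _∧_; _xor_; if_then_else_) renaming (T to True)
open import Data.Bool.Properties using (T-∨; T-∧; not-involutive; not-¬)
open import Data.Empty using (⊥)
open import Data.Fin as Fin using (Fin; toℕ; fromℕ<; punchIn)
open import Data.Fin.Properties using (toℕ-fromℕ<; toℕ-injective; toℕ<n) renaming (any? to anyFin?)
open import Data.Integer using (ℤ; 0ℤ; 1ℤ)
import Data.Integer.Properties as ℤ
open import Algebra.Properties.CommutativeMonoid.Sum ℤ.+-0-commutativeMonoid using (sum; sum-remove)
open import Data.Integer.Tactic.RingSolver using (solve-∀)
open import Data.List as List using (List; []; _∷_; _++_; allFin; cartesianProductWith; concatMap; length; map; tabulate)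
open import Data.List.Membership.Propositional using (_∈_; find; lose)
open import Data.List.Membership.Propositional.Properties
  using (∈-allFin; ∈-map⁺; ∈-map⁻; ∈-++⁺ˡ; ∈-++⁺ʳ; ∈-++⁻; ∈-cartesianProductWith⁺; ∈-cartesianProductWith⁻; ∈-lookup)
open import Data.List.Properties using (length-map; length-++; length-tabulate; map-cong; map-tabulate)
import Data.List.Relation.Unary.All as ListAll
import Data.List.Relation.Unary.AllPairs as AllPairs
open import Data.List.Relation.Unary.Any using (here; there; index; any?)
open import Data.List.Relation.Unary.Any.Properties using (any⁺; any⁻; lookup-index)
open import Data.List.Relation.Unary.Unique.Propositional using (Unique)
import Data.List.Relation.Unary.Unique.Propositional.Properties as Unique
open import Data.Nat as ℕ using (ℕ; zero; suc; pred; _≤_; _<_; z≤n; s≤s; _<ᵇ_; _≡ᵇ_; _≤ᵇ_; _∸_; _%_)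
open import Data.Nat.DivMod using (m%n<n; m<n⇒m%n≡m; m%n%n≡m%n; %-distribˡ-+; [m+n]%n≡m%n; n%n≡0)
import Data.Nat.Properties as ℕ
open import Data.Nat.Tactic.RingSolver using () renaming (solve-∀ to solve-∀ᴺ)
open import Data.Product using (_×_; _,_; proj₁; proj₂; ∃)
open import Data.Sum using (_⊎_; inj₁; inj₂)
open import Data.Unit using (⊤; tt)
open import Data.Vec using (Vec; []; _∷_; head; removeAt)
open import Data.Vec.Functional using (insertAt)
open import Data.Vec.Functional.Properties using (insertAt-lookup; insertAt-punchIn)
open import Data.Vec.Properties using (≡-dec; ∷-injectiveˡ; ∷-injectiveʳ)
open import Data.Vec.Relation.Unary.All using (All; []; _∷_)
open import Function using (_∘_; Equivalence)
open import Relation.Binary.Definitions using (DecidableEquality)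
open import Relation.Binary.PropositionalEquality
open import Relation.Nullary using (¬_; Dec; yes; no; does)
open import Relation.Nullary.Decidable using (¬?; decidable-stable; dec-true; dec-false)
open import Relation.Nullary.Negation using (contradiction)

-- Sums of integers and linear dependence

module Sums where
  open import Data.Integer using (-_; _+_; _*_; _-_)
  open import Data.Fin using (zero; suc)

  ⟦_⟧ : Bool → ℤ
  ⟦ true ⟧  = 1ℤ
  ⟦ false ⟧ = 0ℤ

  ⟦T⟧ : ∀ {b} → True b → ⟦ b ⟧ ≡ 1ℤ
  ⟦T⟧ {true} _ = refl

  ⟦¬T⟧ : ∀ {b} → ¬ True b → ⟦ b ⟧ ≡ 0ℤ
  ⟦¬T⟧ {true}  p = contradiction tt p
  ⟦¬T⟧ {false} _ = refl

  ⟦⟧*⟦⟧-cong : ∀ b c {p q : ℤ} → (True b → True c → p ≡ q) → ⟦ b ⟧ * ⟦ c ⟧ * p ≡ ⟦ b ⟧ * ⟦ c ⟧ * q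
  ⟦⟧*⟦⟧-cong true  true  h = cong (1ℤ *_) (h tt tt)
  ⟦⟧*⟦⟧-cong true  false h = refl
  ⟦⟧*⟦⟧-cong false c     h = refl

  ∑ : ∀ {A : Set} → List A → (A → ℤ) → ℤ
  ∑ xs f = sumℤ (map f xs)

  module _ {A : Set} where

    ∑-cong : ∀ (xs : List A) {f g : A → ℤ} → (∀ x → f x ≡ g x) → ∑ xs f ≡ ∑ xs g
    ∑-cong xs h = cong sumℤ (map-cong h xs)

    ∑-linear : ∀ (xs : List A) a b (f g : A → ℤ) → ∑ xs (λ x → a * f x + b * g x) ≡ a * ∑ xs f + b * ∑ xs g
    ∑-linear []       a b f g = sym (cong₂ _+_ (ℤ.*-zeroʳ a) (ℤ.*-zeroʳ b))
    ∑-linear (x ∷ xs) a b f g = trans (cong (a * f x + b * g x +_) (∑-linear xs a b f g)) (lem a b (f x) (g x) (∑ xs f) (∑ xs g))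
      where
      lem : ∀ a b p q r s → a * p + b * q + (a * r + b * s) ≡ a * (p + r) + b * (q + s)
      lem = solve-∀

    ∑-+ : ∀ (xs : List A) (f g : A → ℤ) → ∑ xs (λ x → f x + g x) ≡ ∑ xs f + ∑ xs g
    ∑-+ []       f g = refl
    ∑-+ (x ∷ xs) f g = trans (cong (f x + g x +_) (∑-+ xs f g)) (lem (f x) (g x) (∑ xs f) (∑ xs g))
      where
      lem : ∀ p q r s → p + q + (r + s) ≡ p + r + (q + s)
      lem = solve-∀

    ∑-*ˡ : ∀ (xs : List A) a (f : A → ℤ) → ∑ xs (λ x → a * f x) ≡ a * ∑ xs f
    ∑-*ˡ []       a f = sym (ℤ.*-zeroʳ a)
    ∑-*ˡ (x ∷ xs) a f = trans (cong (a * f x +_) (∑-*ˡ xs a f)) (sym (ℤ.*-distribˡ-+ a (f x) (∑ xs f)))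

    ∑-0 : ∀ (xs : List A) {f : A → ℤ} → (∀ x → f x ≡ 0ℤ) → ∑ xs f ≡ 0ℤ
    ∑-0 []       h = refl
    ∑-0 (x ∷ xs) h = cong₂ _+_ (h x) (∑-0 xs h)


  ∑-swap : ∀ {A B : Set} (xs : List A) (ys : List B) (f : A → B → ℤ) → ∑ xs (λ x → ∑ ys (f x)) ≡ ∑ ys (λ y → ∑ xs (λ x → f x y))
  ∑-swap []       ys f = sym (∑-0 ys (λ _ → refl))
  ∑-swap (x ∷ xs) ys f = trans (cong (∑ ys (f x) +_) (∑-swap xs ys f)) (sym (∑-+ ys (f x) (λ y → ∑ xs (λ x → f x y))))

  module _ {A : Set} where

    module _ (_≟_ : DecidableEquality A) where

      ∑-indicator-∉ : ∀ xs (f : A → ℤ) y → ListAll.All (y ≢_) xs → ∑ xs (λ x → f x * ⟦ does (y ≟ x) ⟧) ≡ 0ℤ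
      ∑-indicator-∉ []       f y ListAll.[] = refl
      ∑-indicator-∉ (x ∷ xs) f y (y≢x ListAll.∷ y∉) rewrite dec-false (y ≟ x) y≢x =
        cong₂ _+_ (ℤ.*-zeroʳ (f x)) (∑-indicator-∉ xs f y y∉)

      ∑-indicator : ∀ xs (f : A → ℤ) {y} → Unique xs → y ∈ xs → ∑ xs (λ x → f x * ⟦ does (y ≟ x) ⟧) ≡ f y
      ∑-indicator (y ∷ xs) f (y∉ AllPairs.∷ _) (here refl) rewrite dec-true (y ≟ y) refl =
        trans (cong₂ _+_ (ℤ.*-identityʳ (f y)) (∑-indicator-∉ xs f y y∉)) (ℤ.+-identityʳ (f y))
      ∑-indicator (x ∷ xs) f {y} (x∉ AllPairs.∷ u) (there y∈) rewrite dec-false (y ≟ x) (λ y≡x → ListAll.lookup x∉ y∈ (sym y≡x)) =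
        trans (cong₂ _+_ (ℤ.*-zeroʳ (f x)) (∑-indicator xs f u y∈)) (ℤ.+-identityˡ (f y))

    -- Invariance under pointwise equality is a field of its own, since functions that agree
    -- pointwise need not be propositionally equal.
    record Linear (Φ : (A → ℤ) → ℤ) : Set where
      field
        congruent : ∀ {f g} → (∀ x → f x ≡ g x) → Φ f ≡ Φ g
        linear    : ∀ a b f g → Φ (λ x → a * f x + b * g x) ≡ a * Φ f + b * Φ g

      zero-image : Φ (λ _ → 0ℤ) ≡ 0ℤ
      zero-image = linear 0ℤ 0ℤ (λ _ → 0ℤ) (λ _ → 0ℤ)

      ∑-image : ∀ {B : Set} (ys : List B) (a : B → ℤ) (f : B → A → ℤ) →
                Φ (λ x → ∑ ys (λ y → a y * f y x)) ≡ ∑ ys (λ y → a y * Φ (f y))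
      ∑-image []       a f = zero-image
      ∑-image (y ∷ ys) a f =
        trans (congruent (λ x → cong (a y * f y x +_) (sym (ℤ.*-identityˡ (∑ ys (λ y → a y * f y x))))))
        (trans (linear (a y) 1ℤ (f y) (λ x → ∑ ys (λ y → a y * f y x)))
          (cong (a y * Φ (f y) +_) (trans (ℤ.*-identityˡ (Φ (λ x → ∑ ys (λ y → a y * f y x)))) (∑-image ys a f))))

  ∑-allFin : ∀ {n} (f : Fin n → ℤ) → ∑ (allFin n) f ≡ sum f
  ∑-allFin {n} f = trans (cong sumℤ (map-tabulate (λ i → i) f)) (go f)
    where
    go : ∀ {n} (f : Fin n → ℤ) → sumℤ (tabulate f) ≡ sum f
    go {zero}  f = refl
    go {suc n} f = cong (f zero +_) (go (f ∘ suc))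

  ∑-allFin-suc : ∀ {n} (f : Fin (suc n) → ℤ) → ∑ (allFin (suc n)) f ≡ f zero + ∑ (allFin n) (f ∘ suc)
  ∑-allFin-suc f = trans (∑-allFin f) (cong (f zero +_) (sym (∑-allFin (f ∘ suc))))

  ∑-allFin-punchIn : ∀ {n} (i : Fin (suc n)) (f : Fin (suc n) → ℤ) → ∑ (allFin (suc n)) f ≡ f i + ∑ (allFin n) (f ∘ punchIn i)
  ∑-allFin-punchIn i f = trans (∑-allFin f) (trans (sum-remove {i = i} f) (cong (f i +_) (sym (∑-allFin (f ∘ punchIn i)))))

  *≢0 : ∀ {i j} → i ≢ 0ℤ → j ≢ 0ℤ → i * j ≢ 0ℤ
  *≢0 {i} i≢0 j≢0 eq with ℤ.i*j≡0⇒i≡0∨j≡0 i eq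
  ... | inj₁ i≡0 = i≢0 i≡0
  ... | inj₂ j≡0 = j≢0 j≡0

  -- Fraction-free Gaussian elimination.
  dependent : ∀ r (A : Fin (suc r) → Fin r → ℤ) →
    ∃ λ (a : Fin (suc r) → ℤ) → ∃ (λ j → a j ≢ 0ℤ) × (∀ i → ∑ (allFin (suc r)) (λ j → a j * A j i) ≡ 0ℤ)
  dependent zero    A = (λ _ → 1ℤ) , (zero , λ ()) , λ ()
  dependent (suc r) A with anyFin? (λ j → ¬? (A j zero ℤ.≟ 0ℤ))
  ... | no all-zero = a , (let j , a′j≢0 = nz in suc j , a′j≢0) , rel
    where
    IH = dependent r (λ j i → A (suc j) (suc i))
    a′ = proj₁ IH
    nz = proj₁ (proj₂ IH)
    rel′ = proj₂ (proj₂ IH)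
    a : Fin (suc (suc r)) → ℤ
    a zero    = 0ℤ
    a (suc j) = a′ j
    rel : ∀ i → ∑ (allFin (suc (suc r))) (λ j → a j * A j i) ≡ 0ℤ
    rel zero    = ∑-0 (allFin (suc (suc r))) λ j →
      trans (cong (a j *_) (decidable-stable (A j zero ℤ.≟ 0ℤ) (λ ≢0 → all-zero (j , ≢0)))) (ℤ.*-zeroʳ (a j))
    rel (suc i) = trans (∑-allFin-suc (λ j → a j * A j (suc i))) (trans (ℤ.+-identityˡ _) (rel′ i))
  ... | yes (p , c≢0) = a , (let j , a′j≢0 = nz in punchIn p j , λ eq → *≢0 c≢0 a′j≢0 (trans (sym (a-punchIn j)) eq)) , rel
    where
    c = A p zero
    B : Fin (suc r) → Fin (suc r) → ℤ
    B j i = A (punchIn p j) i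
    IH = dependent r (λ j i → c * B j (suc i) - B j zero * A p (suc i))
    a′ = proj₁ IH
    nz = proj₁ (proj₂ IH)
    rel′ = proj₂ (proj₂ IH)
    q : ℤ
    q = - ∑ (allFin (suc r)) (λ j → a′ j * B j zero)
    a : Fin (suc (suc r)) → ℤ
    a = insertAt (λ j → c * a′ j) p q
    a-punchIn : ∀ j → a (punchIn p j) ≡ c * a′ j
    a-punchIn = insertAt-punchIn (λ j → c * a′ j) p q
    expand : ∀ i → ∑ (allFin (suc (suc r))) (λ j → a j * A j i) ≡ q * A p i + c * ∑ (allFin (suc r)) (λ j → a′ j * B j i)
    expand i = trans (∑-allFin-punchIn p (λ j → a j * A j i)) (cong₂ _+_
      (cong (_* A p i) (insertAt-lookup (λ j → c * a′ j) p q))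
      (trans (∑-cong (allFin (suc r)) (λ j → trans (cong (_* B j i) (a-punchIn j)) (ℤ.*-assoc c (a′ j) (B j i))))
             (∑-*ˡ (allFin (suc r)) c (λ j → a′ j * B j i))))
    rel : ∀ i → ∑ (allFin (suc (suc r))) (λ j → a j * A j i) ≡ 0ℤ
    rel zero    = trans (expand zero) (lem (∑ (allFin (suc r)) (λ j → a′ j * B j zero)) c)
      where
      lem : ∀ s c → - s * c + c * s ≡ 0ℤ
      lem = solve-∀
    rel (suc i) = trans (expand (suc i))
      (trans (lem (∑ (allFin (suc r)) (λ j → a′ j * B j zero)) (A p (suc i)) c
                  (∑ (allFin (suc r)) (λ j → a′ j * B j (suc i))))
        (trans (sym (∑-linear (allFin (suc r)) c (- A p (suc i)) (λ j → a′ j * B j (suc i)) (λ j → a′ j * B j zero)))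
          (trans (∑-cong (allFin (suc r)) (λ j → lem₂ c (A p (suc i)) (a′ j) (B j (suc i)) (B j zero))) (rel′ i))))
      where
      lem : ∀ s p c t → - s * p + c * t ≡ c * t + - p * s
      lem = solve-∀
      lem₂ : ∀ c p a x y → c * (a * x) + - p * (a * y) ≡ a * (c * x - y * p)
      lem₂ = solve-∀

  lookup-unique : ∀ {A : Set} {xs : List A} → Unique xs → ∀ i j → List.lookup xs i ≡ List.lookup xs j → i ≡ j
  lookup-unique (x∉ AllPairs.∷ u) zero    zero    eq = refl
  lookup-unique (x∉ AllPairs.∷ u) zero    (suc j) eq = contradiction eq (ListAll.lookup x∉ (∈-lookup j))
  lookup-unique (x∉ AllPairs.∷ u) (suc i) zero    eq = contradiction (sym eq) (ListAll.lookup x∉ (∈-lookup i))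
  lookup-unique (x∉ AllPairs.∷ u) (suc i) (suc j) eq = cong suc (lookup-unique u i j eq)

open Sums

length-cartesianProductWith : ∀ {A B C : Set} (f : A → B → C) xs ys → length (cartesianProductWith f xs ys) ≡ length xs ℕ.* length ys
length-cartesianProductWith f []       ys = refl
length-cartesianProductWith f (x ∷ xs) ys =
  trans (length-++ (map (f x) ys)) (cong₂ ℕ._+_ (length-map (f x) ys) (length-cartesianProductWith f xs ys))

concatMap-map : ∀ {A B C : Set} (f : A → B → C) xs ys → concatMap (λ x → map (f x) ys) xs ≡ cartesianProductWith f xs ys
concatMap-map f []       ys = refl
concatMap-map f (x ∷ xs) ys = cong (map (f x) ys ++_) (concatMap-map f xs ys)

≡ᵇ-cancelˡ : ∀ d a b → (d ℕ.+ a ≡ᵇ d ℕ.+ b) ≡ (a ≡ᵇ b)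
≡ᵇ-cancelˡ zero    a b = refl
≡ᵇ-cancelˡ (suc d) a b = ≡ᵇ-cancelˡ d a b

≡ᵇ-cancelʳ : ∀ a b d → (a ℕ.+ d ≡ᵇ b ℕ.+ d) ≡ (a ≡ᵇ b)
≡ᵇ-cancelʳ a b d = trans (cong₂ _≡ᵇ_ (ℕ.+-comm a d) (ℕ.+-comm b d)) (≡ᵇ-cancelˡ d a b)

-- The differential as a recursion along the tuple

module Faces (n : ℕ) (adj : Fin n → Fin n → Bool) where
  open import Data.Integer using (-_; _+_; _*_; _-_)
  open import Data.Fin using (zero; suc)
  open Graph n adj

  e : ∀ {k} → Tup k → Tup k → ℤ
  e y x = ⟦ does (≡-dec Fin._≟_ x y) ⟧

  -- Whether `y` may be omitted is a local condition, because the distances behind `z` cancel. The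
  -- later faces are faces of the tail with the index shifted by one, which costs a sign.
  δᶠ : ∀ {k} → (Tup k → ℤ) → Tup (suc k) → ℤ
  δᶠ f (x ∷ y ∷ [])     = 0ℤ
  δᶠ f (x ∷ y ∷ z ∷ xs) =
    - (⟦ dist x z ≡ᵇ dist x y ℕ.+ dist y z ⟧ * f (x ∷ z ∷ xs)) - δᶠ (λ t → f (x ∷ t)) (y ∷ z ∷ xs)

  -- The summand of `∂coeff` with an arbitrary predicate in place of the comparison with a fixed
  -- tuple: the induction over tails prefixes a vertex inside the test, which changes the predicate.
  face : ∀ k → (Tup k → Bool) → Tup (suc k) → Fin (suc (suc k)) → ℤ
  face k P x i = if (1 ≤ᵇ toℕ i) ∧ (toℕ i ≤ᵇ k) ∧ P (removeAt x i) ∧ (len (removeAt x i) ≡ᵇ len x)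
                 then sign (toℕ i) else 0ℤ

  if-neg : ∀ b z → (if b then - z else 0ℤ) ≡ - (if b then z else 0ℤ)
  if-neg true  z = refl
  if-neg false z = refl

  ∑-neg : ∀ {A : Set} (xs : List A) (f : A → ℤ) → ∑ xs (λ x → - f x) ≡ - ∑ xs f
  ∑-neg xs f = trans (∑-cong xs (λ x → neg (f x))) (trans (∑-*ˡ xs (- 1ℤ) f) (sym (neg (∑ xs f))))
    where
    neg : ∀ p → - p ≡ - 1ℤ * p
    neg = solve-∀

  ∑-face : ∀ k (P : Tup k → Bool) x → ∑ (allFin (suc (suc k))) (face k P x) ≡ δᶠ (λ t → ⟦ P t ⟧) x
  ∑-face zero    P (x ∷ y ∷ [])     = refl
  ∑-face (suc k) P x₀@(x ∷ y ∷ z ∷ xs) = begin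
    ∑ (allFin (3 ℕ.+ k)) (face (suc k) P x₀)
      ≡⟨ trans (∑-allFin-suc (face (suc k) P x₀)) (ℤ.+-identityˡ _) ⟩
    ∑ (allFin (2 ℕ.+ k)) (face (suc k) P x₀ ∘ suc)
      ≡⟨ ∑-allFin-suc (face (suc k) P x₀ ∘ suc) ⟩
    face (suc k) P x₀ (suc zero) + ∑ (allFin (suc k)) (λ i → face (suc k) P x₀ (suc (suc i)))
      ≡⟨ cong₂ _+_ first (trans (∑-cong (allFin (suc k)) rest) (∑-neg (allFin (suc k)) (face k P′ (y ∷ z ∷ xs) ∘ suc))) ⟩
    A - ∑ (allFin (suc k)) (face k P′ (y ∷ z ∷ xs) ∘ suc)
      ≡⟨ cong (λ p → A - p) (trans (sym (trans (∑-allFin-suc (face k P′ (y ∷ z ∷ xs))) (ℤ.+-identityˡ _))) (∑-face k P′ (y ∷ z ∷ xs))) ⟩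
    δᶠ (λ t → ⟦ P t ⟧) x₀ ∎
    where
    open ≡-Reasoning
    P′ : Tup k → Bool
    P′ t = P (x ∷ t)
    A = - (⟦ dist x z ≡ᵇ dist x y ℕ.+ dist y z ⟧ * ⟦ P (x ∷ z ∷ xs) ⟧)
    if-∧ : ∀ b c → (if b ∧ c then - 1ℤ else 0ℤ) ≡ - (⟦ c ⟧ * ⟦ b ⟧)
    if-∧ true  true  = refl
    if-∧ true  false = refl
    if-∧ false true  = refl
    if-∧ false false = refl
    first : face (suc k) P x₀ (suc zero) ≡ A
    first = trans (cong (λ c → if P (x ∷ z ∷ xs) ∧ c then - 1ℤ else 0ℤ)
                    (trans (cong (dist x z ℕ.+ len (z ∷ xs) ≡ᵇ_) (sym (ℕ.+-assoc (dist x y) (dist y z) (len (z ∷ xs)))))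
                           (≡ᵇ-cancelʳ (dist x z) (dist x y ℕ.+ dist y z) (len (z ∷ xs)))))
                  (if-∧ (P (x ∷ z ∷ xs)) _)
    rest : ∀ i → face (suc k) P x₀ (suc (suc i)) ≡ - face k P′ (y ∷ z ∷ xs) (suc i)
    rest i = trans (cong (λ c → if (suc (toℕ i) ≤ᵇ k) ∧ P (removeAt x₀ (suc (suc i))) ∧ c then - sign (suc (toℕ i)) else 0ℤ)
                      (≡ᵇ-cancelˡ (dist x y) _ _))
                   (if-neg ((suc (toℕ i) ≤ᵇ k) ∧ P (removeAt x₀ (suc (suc i))) ∧ _) (sign (suc (toℕ i))))

  ∂coeff≡ : ∀ k x y → ∂coeff k x y ≡ δᶠ (e y) x
  ∂coeff≡ k x y = ∑-face k (λ t → does (≡-dec Fin._≟_ t y)) x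

-- The distance as the least successful radius

search : (n : ℕ) (adj : Fin n → Fin n → Bool) → Fin n → Fin n → ℕ → ℕ → ℕ
search n adj x y zero    k = k
search n adj x y (suc f) k = if Graph.within n adj k x y then k else search n adj x y f (suc k)

-- The search function local to Graph.dist cannot be named.  Abstracting suc p separates the number of vertices from
-- the fuel p, after which the omitted left-hand side of search-unique is determined by unification.
search-unique : ∀ f n (adj : Fin n → Fin n → Bool) x y k → _ ≡ search n adj x y f k
dist≡search : ∀ n (adj : Fin n → Fin n → Bool) x y → Graph.dist n adj x y ≡ search n adj x y n 0
dist≡search (suc p) adj x y with Graph.within (suc p) adj 0 x y
... | true  = refl
... | false with suc p | adj | x | y | 1
...   | n | adj′ | x′ | y′ | k = search-unique p n adj′ x′ y′ k
search-unique zero    n adj x y k = refl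
search-unique (suc f) n adj x y k with Graph.within n adj k x y
... | true  = refl
... | false = search-unique f n adj x y (suc k)

search-least : ∀ n (adj : Fin n → Fin n → Bool) x y r → True (Graph.within n adj r x y) →
  (∀ k → k < r → ¬ True (Graph.within n adj k x y)) →
  ∀ f k → k ≤ r → r ≤ f ℕ.+ k → search n adj x y f k ≡ r
search-least n adj x y r hit miss zero    k k≤r r≤k = ℕ.≤-antisym k≤r r≤k
search-least n adj x y r hit miss (suc f) k k≤r r≤ with Graph.within n adj k x y in eq
... | true  with ℕ.m≤n⇒m<n∨m≡n k≤r
...   | inj₁ k<r = contradiction (subst True (sym eq) tt) (miss k k<r)
...   | inj₂ k≡r = k≡r
search-least n adj x y r hit miss (suc f) k k≤r r≤ | false with ℕ.m≤n⇒m<n∨m≡n k≤r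
... | inj₁ k<r = search-least n adj x y r hit miss f (suc k) k<r (subst (r ≤_) (sym (ℕ.+-suc f k)) r≤)
... | inj₂ refl = contradiction (subst True eq hit) λ ()

dist-least : ∀ n (adj : Fin n → Fin n → Bool) x y r → r ≤ n → True (Graph.within n adj r x y) →
  (∀ k → k < r → ¬ True (Graph.within n adj k x y)) → Graph.dist n adj x y ≡ r
dist-least n adj x y r r≤n hit miss =
  trans (dist≡search n adj x y) (search-least n adj x y r hit miss n 0 z≤n (subst (r ≤_) (sym (ℕ.+-identityʳ n)) r≤n))

-- Directed runs on a cycle

suc-% : ∀ k n .{{_ : ℕ.NonZero n}} → suc (k % n) % n ≡ suc k % n
suc-% k n = trans (%-distribˡ-+ 1 (k % n) n) (trans (cong (λ z → (1 % n ℕ.+ z) % n) (m%n%n≡m%n k n)) (sym (%-distribˡ-+ 1 k n)))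

module CycleGraph (N : ℕ) where
  n : ℕ
  n = suc N

  V : Set
  V = Fin n

  open Graph n (cycleAdj n) using (within)

  next : V → V
  next x = fromℕ< (m%n<n (suc (toℕ x)) n)

  toℕ-next : ∀ x → toℕ (next x) ≡ suc (toℕ x) % n
  toℕ-next x = toℕ-fromℕ< _

  next^ : ℕ → V → V
  next^ zero    x = x
  next^ (suc r) x = next (next^ r x)

  next^-+ : ∀ r s x → next^ (r ℕ.+ s) x ≡ next^ r (next^ s x)
  next^-+ zero    s x = refl
  next^-+ (suc r) s x = cong next (next^-+ r s x)

  next^-comm : ∀ r s x → next^ r (next^ s x) ≡ next^ (s ℕ.+ r) x
  next^-comm r s x = trans (sym (next^-+ r s x)) (cong (λ z → next^ z x) (ℕ.+-comm r s))

  toℕ-next^ : ∀ r x → toℕ (next^ r x) ≡ (r ℕ.+ toℕ x) % n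
  toℕ-next^ zero    x = sym (m<n⇒m%n≡m (toℕ<n x))
  toℕ-next^ (suc r) x = trans (toℕ-next _) (trans (cong (λ z → suc z % n) (toℕ-next^ r x)) (suc-% (r ℕ.+ toℕ x) n))

  next^-n : ∀ x → next^ n x ≡ x
  next^-n x = toℕ-injective (trans (toℕ-next^ n x)
    (trans (cong (_% n) (ℕ.+-comm n (toℕ x))) (trans ([m+n]%n≡m%n (toℕ x) n) (m<n⇒m%n≡m (toℕ<n x)))))

  next^-inverse : ∀ r x → r ≤ n → next^ (n ∸ r) (next^ r x) ≡ x
  next^-inverse r x r≤n = trans (next^-comm (n ∸ r) r x) (trans (cong (λ z → next^ z x) (ℕ.m+[n∸m]≡n r≤n)) (next^-n x))

  next^-inverse′ : ∀ r x → r ≤ n → next^ r (next^ (n ∸ r) x) ≡ x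
  next^-inverse′ r x r≤n = trans (next^-comm r (n ∸ r) x) (trans (cong (λ z → next^ z x) (ℕ.m∸n+n≡m r≤n)) (next^-n x))

  next^-injective : ∀ r {x y} → r ≤ n → next^ r x ≡ next^ r y → x ≡ y
  next^-injective r {x} {y} r≤n eq = trans (sym (next^-inverse r x r≤n)) (trans (cong (next^ (n ∸ r)) eq) (next^-inverse r y r≤n))

  -- Since r + x lies below 2n, reduction modulo n subtracts n at most once: without wrapping r is
  -- 0, and with wrapping r would be n.
  next^-aperiodic : ∀ r x → r < n → next^ r x ≡ x → r ≡ 0
  next^-aperiodic r x r<n eq with r ℕ.+ toℕ x ℕ.<? n
  ... | yes lt = ℕ.+-cancelʳ-≡ (toℕ x) r 0 (trans (sym (m<n⇒m%n≡m lt)) (trans (sym (toℕ-next^ r x)) (cong toℕ eq)))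
  ... | no ≮n = contradiction r≡n (ℕ.<⇒≢ r<n)
    where
    e = (r ℕ.+ toℕ x) ∸ n
    e+n : e ℕ.+ n ≡ r ℕ.+ toℕ x
    e+n = ℕ.m∸n+n≡m (ℕ.≮⇒≥ ≮n)
    e<n : e < n
    e<n = ℕ.+-cancelʳ-< n e n (subst (_< n ℕ.+ n) (sym e+n) (ℕ.+-mono-< r<n (toℕ<n x)))
    e≡x : e ≡ toℕ x
    e≡x = trans (sym (m<n⇒m%n≡m e<n)) (trans (sym ([m+n]%n≡m%n e n))
            (trans (cong (_% n) e+n) (trans (sym (toℕ-next^ r x)) (cong toℕ eq))))
    r≡n : r ≡ n
    r≡n = ℕ.+-cancelʳ-≡ (toℕ x) r n (trans (sym e+n) (trans (cong (ℕ._+ n) e≡x) (ℕ.+-comm (toℕ x) n)))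

  -- The difference y - x modulo n, with `n ∸ toℕ x` standing for -x.
  gap : V → V → ℕ
  gap x y = (toℕ y ℕ.+ (n ∸ toℕ x)) % n

  gap<n : ∀ x y → gap x y < n
  gap<n x y = m%n<n (toℕ y ℕ.+ (n ∸ toℕ x)) n

  next^-gap : ∀ x y → next^ (gap x y) x ≡ y
  next^-gap x y = toℕ-injective (begin
    toℕ (next^ (gap x y) x)        ≡⟨ toℕ-next^ (gap x y) x ⟩
    (k % n ℕ.+ toℕ x) % n          ≡⟨ %-distribˡ-+ (k % n) (toℕ x) n ⟩
    (k % n % n ℕ.+ toℕ x % n) % n  ≡⟨ cong (λ z → (z ℕ.+ toℕ x % n) % n) (m%n%n≡m%n k n) ⟩
    (k % n ℕ.+ toℕ x % n) % n      ≡⟨ %-distribˡ-+ k (toℕ x) n ⟨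
    (k ℕ.+ toℕ x) % n              ≡⟨ cong (_% n) (trans (ℕ.+-assoc (toℕ y) _ _) (cong (toℕ y ℕ.+_) (ℕ.m∸n+n≡m (ℕ.<⇒≤ (toℕ<n x))))) ⟩
    (toℕ y ℕ.+ n) % n              ≡⟨ [m+n]%n≡m%n (toℕ y) n ⟩
    toℕ y % n                      ≡⟨ m<n⇒m%n≡m (toℕ<n y) ⟩
    toℕ y                          ∎)
    where
    open ≡-Reasoning
    k = toℕ y ℕ.+ (n ∸ toℕ x)

  -- A backward run is recorded as a forward run from its target, so that no inverse of `next` and
  -- no subtraction modulo n is needed.
  Step : Bool → ℕ → V → V → Set
  Step true  r x y = next^ r x ≡ y
  Step false r x y = next^ r y ≡ x

  step-0⁻ : ∀ s {x y} → Step s 0 x y → x ≡ y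
  step-0⁻ true  eq = eq
  step-0⁻ false eq = sym eq

  step-+ : ∀ s {r r′ x y z} → Step s r x y → Step s r′ y z → Step s (r ℕ.+ r′) x z
  step-+ true  {r} {r′} refl refl = sym (next^-comm r′ r _)
  step-+ false {r} {r′} refl refl = next^-+ r r′ _

  step-split : ∀ s {r r′ x z} → r ℕ.+ r′ ≤ n → Step s (r ℕ.+ r′) x z → ∃ λ y → Step s r x y × Step s r′ y z
  step-split true  {r} {r′} {x} le eq = next^ r x , refl , trans (next^-comm r′ r x) eq
  step-split false {r} {r′} {x} {z} le eq = next^ r′ z , trans (sym (next^-+ r r′ z)) eq , refl

  step-not : ∀ s {r x y} → r ≤ n → Step s r x y → Step (not s) (n ∸ r) x y
  step-not true  {r} r≤n refl = next^-inverse r _ r≤n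
  step-not false {r} r≤n refl = next^-inverse r _ r≤n

  step-back : ∀ s {r r′ x y z} → r ≤ n → r′ ≤ r → Step s r x y → Step (not s) r′ y z → Step s (r ∸ r′) x z
  step-back true  {r} {r′} {x} {y} {z} r≤n r′≤r p q = next^-injective r′ (ℕ.≤-trans r′≤r r≤n)
    (trans (next^-comm r′ (r ∸ r′) x) (trans (cong (λ k → next^ k x) (ℕ.m∸n+n≡m r′≤r)) (trans p (sym q))))
  step-back false {r} {r′} {x} {y} {z} r≤n r′≤r p q =
    trans (cong (next^ (r ∸ r′)) (sym q)) (trans (next^-comm (r ∸ r′) r′ y) (trans (cong (λ k → next^ k y) (ℕ.m+[n∸m]≡n r′≤r)) p))

  step-back′ : ∀ s {r r′ x y z} → r′ ≤ n → r ≤ r′ → Step s r x y → Step (not s) r′ y z → Step (not s) (r′ ∸ r) x z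
  step-back′ true  {r} {r′} {x} {y} {z} r′≤n r≤r′ p q = next^-injective r (ℕ.≤-trans r≤r′ r′≤n)
    (trans (next^-comm r (r′ ∸ r) z) (trans (cong (λ k → next^ k z) (ℕ.m∸n+n≡m r≤r′)) (trans q (sym p))))
  step-back′ false {r} {r′} {x} {y} {z} r′≤n r≤r′ p q =
    trans (cong (next^ (r′ ∸ r)) (sym p)) (trans (next^-comm (r′ ∸ r) r y) (trans (cong (λ k → next^ k y) (ℕ.m+[n∸m]≡n r≤r′)) q))

  step-target : ∀ s {r x y z} → r ≤ n → Step s r x y → Step s r x z → y ≡ z
  step-target true  _   p q = trans (sym p) q
  step-target false {r} r≤n p q = next^-injective r r≤n (trans p (sym q))

  step-loop : ∀ s {r x} → r < n → Step s r x x → r ≡ 0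
  step-loop true  {r} r<n eq = next^-aperiodic r _ r<n eq
  step-loop false {r} r<n eq = next^-aperiodic r _ r<n eq

  step-unique-≤ : ∀ s {r r′ x y} → r ≤ r′ → r′ < n → Step s r x y → Step s r′ x y → r ≡ r′
  step-unique-≤ s {r} {r′} {x} {y} r≤r′ r′<n p q with step-split s {r} {r′ ∸ r} (subst (_≤ n) (sym (ℕ.m+[n∸m]≡n r≤r′)) (ℕ.<⇒≤ r′<n))
                                               (subst (λ k → Step s k x y) (sym (ℕ.m+[n∸m]≡n r≤r′)) q)
  ... | z , p′ , q′ with step-target s (ℕ.≤-trans r≤r′ (ℕ.<⇒≤ r′<n)) p′ p
  ...   | refl = trans (sym (ℕ.+-identityʳ r))
                 (trans (cong (r ℕ.+_) (sym (step-loop s (ℕ.≤-<-trans (ℕ.m∸n≤m r′ r) r′<n) q′))) (ℕ.m+[n∸m]≡n r≤r′))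

  step-unique : ∀ s {r r′ x y} → r < n → r′ < n → Step s r x y → Step s r′ x y → r ≡ r′
  step-unique s {r} {r′} r<n r′<n p q with ℕ.≤-total r r′
  ... | inj₁ r≤r′ = step-unique-≤ s r≤r′ r′<n p q
  ... | inj₂ r′≤r = sym (step-unique-≤ s r′≤r r<n q p)

  step-opposite : ∀ s {r r′ x y} → r < n → r′ < n → Step s r x y → Step (not s) r′ x y → r ≡ 0 ⊎ r ℕ.+ r′ ≡ n
  -- Size 0 is treated apart: its complement is n, which lies outside the range of `step-unique`.
  step-opposite s {r} {zero} r<n r′<n p q with step-0⁻ (not s) q
  ... | refl = inj₁ (step-loop s r<n p)
  step-opposite s {r} {suc r′} {x} {y} r<n r′<n p q =
    inj₂ (trans (cong (ℕ._+ suc r′) r≡) (ℕ.m∸n+n≡m (ℕ.<⇒≤ r′<n)))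
    where
    r≡ : r ≡ n ∸ suc r′
    r≡ = step-unique s r<n (s≤s (ℕ.m∸n≤m N r′)) p
           (subst (λ t → Step t (n ∸ suc r′) x y) (not-involutive s) (step-not (not s) (ℕ.<⇒≤ r′<n) q))

  adj⇒step : ∀ x y → True (cycleAdj n x y) → ∃ λ s → Step s 1 x y
  adj⇒step x y p with Equivalence.to T-∨ p
  ... | inj₁ q = true , toℕ-injective (trans (toℕ-next x) (trans (cong (_% n) sx≡y) (m<n⇒m%n≡m (toℕ<n y))))
    where sx≡y = ℕ.≡ᵇ⇒≡ (suc (toℕ x)) (toℕ y) q
  ... | inj₂ q with Equivalence.to T-∨ q
  ...   | inj₁ r = false , toℕ-injective (trans (toℕ-next y) (trans (cong (_% n) (ℕ.≡ᵇ⇒≡ (suc (toℕ y)) (toℕ x) r)) (m<n⇒m%n≡m (toℕ<n x))))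
  ...   | inj₂ r with Equivalence.to T-∨ r
  ...     | inj₁ u = let (x≡0 , sy≡n) = Equivalence.to T-∧ u in
            false , toℕ-injective (trans (toℕ-next y) (trans (cong (_% n) (ℕ.≡ᵇ⇒≡ (suc (toℕ y)) n sy≡n))
              (trans (n%n≡0 n) (sym (ℕ.≡ᵇ⇒≡ (toℕ x) 0 x≡0)))))
  ...     | inj₂ u = let (y≡0 , sx≡n) = Equivalence.to T-∧ u in
            true , toℕ-injective (trans (toℕ-next x) (trans (cong (_% n) (ℕ.≡ᵇ⇒≡ (suc (toℕ x)) n sx≡n))
              (trans (n%n≡0 n) (sym (ℕ.≡ᵇ⇒≡ (toℕ y) 0 y≡0)))))

  next-cases : ∀ x → (suc (toℕ x) ≡ toℕ (next x)) ⊎ (toℕ (next x) ≡ 0 × suc (toℕ x) ≡ n)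
  next-cases x with suc (toℕ x) ℕ.<? n
  ... | yes lt = inj₁ (sym (trans (toℕ-next x) (m<n⇒m%n≡m lt)))
  ... | no ≮n  = let sx≡n = ℕ.≤-antisym (toℕ<n x) (ℕ.≮⇒≥ ≮n) in
                 inj₂ (trans (toℕ-next x) (trans (cong (_% n) sx≡n) (n%n≡0 n)) , sx≡n)

  step⇒adj : ∀ s x y → Step s 1 x y → True (cycleAdj n x y)
  step⇒adj true x y refl with next-cases x
  ... | inj₁ eq = Equivalence.from T-∨ (inj₁ (ℕ.≡⇒≡ᵇ (suc (toℕ x)) (toℕ y) eq))
  ... | inj₂ (y≡0 , sx≡n) = Equivalence.from (T-∨ {suc (toℕ x) ≡ᵇ toℕ y}) (inj₂ (Equivalence.from (T-∨ {suc (toℕ y) ≡ᵇ toℕ x}) (inj₂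
      (Equivalence.from (T-∨ {(toℕ x ≡ᵇ 0) ∧ (suc (toℕ y) ≡ᵇ n)}) (inj₂
        (Equivalence.from T-∧ (ℕ.≡⇒≡ᵇ (toℕ y) 0 y≡0 , ℕ.≡⇒≡ᵇ (suc (toℕ x)) n sx≡n)))))))
  step⇒adj false x y refl with next-cases y
  ... | inj₁ eq = Equivalence.from (T-∨ {suc (toℕ x) ≡ᵇ toℕ y}) (inj₂ (Equivalence.from T-∨ (inj₁ (ℕ.≡⇒≡ᵇ (suc (toℕ y)) (toℕ x) eq))))
  ... | inj₂ (x≡0 , sy≡n) = Equivalence.from (T-∨ {suc (toℕ x) ≡ᵇ toℕ y}) (inj₂ (Equivalence.from (T-∨ {suc (toℕ y) ≡ᵇ toℕ x}) (inj₂
      (Equivalence.from T-∨ (inj₁ (Equivalence.from T-∧ (ℕ.≡⇒≡ᵇ (toℕ x) 0 x≡0 , ℕ.≡⇒≡ᵇ (suc (toℕ y)) n sy≡n)))))))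

  -- A walk reaches nothing that a directed run of at most the same length does not: one more edge
  -- either prolongs the run by one or undoes its last edge, and from an empty run it starts a new
  -- one.
  within-sound : ∀ k x y → k < n → True (within k x y) → ∃ λ s → ∃ λ r → r ≤ k × Step s r x y
  within-sound zero x y _ p with x Fin.≟ y
  ... | yes refl = true , 0 , z≤n , refl
  within-sound (suc k) x y k<n p with Equivalence.to T-∨ p
  ... | inj₁ q = let s , r , r≤k , st = within-sound k x y (ℕ.<⇒≤ k<n) q in s , r , ℕ.≤-trans r≤k (ℕ.n≤1+n k) , st
  ... | inj₂ q with find (any⁻ _ (allFin n) q)
  ...   | z , _ , w with Equivalence.to T-∧ w
  ...     | xz , zy with within-sound k x z (ℕ.<⇒≤ k<n) xz | adj⇒step z y zy
  ...       | s , r , r≤k , st | t , st′ = extend s r t r≤k st st′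
    where
    extend : ∀ s r t → r ≤ k → Step s r x z → Step t 1 z y → ∃ λ s → ∃ λ r → r ≤ suc k × Step s r x y
    same : ∀ s r → r ≤ k → Step s r x z → Step s 1 z y → ∃ λ s → ∃ λ r → r ≤ suc k × Step s r x y
    same s r r≤k p q = s , r ℕ.+ 1 , subst (_≤ suc k) (ℕ.+-comm 1 r) (s≤s r≤k) , step-+ s p q
    opposite : ∀ s r → r ≤ k → Step s r x z → Step (not s) 1 z y → ∃ λ s → ∃ λ r → r ≤ suc k × Step s r x y
    opposite s zero    r≤k p q with step-0⁻ s p
    ... | refl = not s , 1 , s≤s z≤n , q
    opposite s (suc r) r≤k p q = s , r , ℕ.≤-trans (ℕ.n≤1+n r) (ℕ.≤-trans r≤k (ℕ.n≤1+n k)) ,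
      step-back s (ℕ.≤-trans r≤k (ℕ.<⇒≤ (ℕ.<⇒≤ k<n))) (s≤s z≤n) p q
    extend true  r true  = same true r
    extend false r false = same false r
    extend true  r false = opposite true r
    extend false r true  = opposite false r

  within-complete : ∀ s k x y → k ≤ n → Step s k x y → True (within k x y)
  within-complete s zero x y _ st with step-0⁻ s st
  ... | refl = subst True (sym (dec-true (x Fin.≟ x) refl)) tt
  within-complete s (suc k) x y k<n st
    with step-split s {k} {1} (subst (_≤ n) (ℕ.+-comm 1 k) k<n) (subst (λ r → Step s r x y) (ℕ.+-comm 1 k) st)
  ... | z , p , q = Equivalence.from (T-∨ {within k x y}) (inj₂ (any⁺ _ (lose (∈-allFin z)
          (Equivalence.from T-∧ (within-complete s k x z (ℕ.<⇒≤ k<n) p , step⇒adj s z y q)))))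

-- Contraction of the complex of words

module OddCycle (M : ℕ) where
  open import Data.Integer using (-_; _+_; _*_; _-_)

  -- (s , i) is a step of size i + 1 in direction s, and M is m - 1.
  Letter : Set
  Letter = Bool × ℕ

  Word : ℕ → Set
  Word = Vec Letter

  Valid : ∀ {k} → Word k → Set
  Valid = All (λ a → proj₂ a ≤ M)

  size : Letter → ℕ
  size (_ , i) = suc i

  total : ∀ {k} → Word k → ℕ
  total []      = 0
  total (a ∷ w) = size a ℕ.+ total w

  _⊕_ : Letter → Letter → Letter
  (s , i) ⊕ (_ , j) = s , suc (i ℕ.+ j)

  one top dec : Letter → Letter
  one (s , _) = s , 0
  top (s , _) = s , M
  dec (s , i) = s , pred i

  _≈ˢ_ : Bool → Bool → Bool
  s ≈ˢ t = not (s xor t)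

  -- χ: a and b can be merged; ε: same direction and sizes adding up to m + 1; o: a unit step followed by a turn.
  χ ε o : Letter → Letter → ℤ
  χ (s , i) (t , j) = ⟦ s ≈ˢ t ⟧ * ⟦ i ℕ.+ j <ᵇ M ⟧
  ε (s , i) (t , j) = ⟦ s ≈ˢ t ⟧ * ⟦ i ℕ.+ j ≡ᵇ M ⟧
  o (s , i) (t , j) = ⟦ s xor t ⟧ * ⟦ i ≡ᵇ 0 ⟧

  η u : Letter → ℤ
  η (_ , i) = ⟦ not (i ≡ᵇ 0) ⟧
  u (_ , i) = ⟦ i ≡ᵇ 0 ⟧

  Cochain : ℕ → Set
  Cochain k = Word k → ℤ

  δ : ∀ {k} → Cochain k → Cochain (suc k)
  δ f (a ∷ [])    = 0ℤ
  δ f (a ∷ b ∷ w) = - (χ a b * f (a ⊕ b ∷ w)) - δ (λ v → f (a ∷ v)) (b ∷ w)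

  -- The minus sign compensates the sign of the first face in `δ`, so that splitting a step and
  -- merging it again gives back the word itself.
  H¹ : ∀ {k} → Cochain (suc (suc k)) → Cochain (suc k)
  H¹ f (a ∷ w) = - (η a * f (one a ∷ dec a ∷ w))

  -- The shape of what `H¹` leaves over. Every pair with sizes adding up to m + 1, not only (1, m)
  -- itself, takes part in the first summand and is read as (1, m); `g₁` and `g₂` say what happens
  -- behind the pair and behind the unit.
  E : ∀ {k} → (Letter → Cochain k) → (Letter → Cochain (suc k)) → Cochain (suc (suc k))
  E g₁ g₂ (a ∷ b ∷ w) = ε a b * g₁ (one a) w + o a b * g₂ (one a) (b ∷ w)

  _⟨_⟩ : ∀ {k} → Cochain (suc k) → Letter → Cochain k
  (f ⟨ a ⟩) v = f (a ∷ v)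

  -- The recursive calls are an instance of `E`. By `δE` a differential passes a pair with sign +
  -- and a single unit with sign -, hence the minus in front of the last call only.
  H : ∀ {k} → Cochain (suc k) → Cochain k
  H f []          = 0ℤ
  H f (a ∷ [])    = H¹ f (a ∷ [])
  H f (a ∷ b ∷ w) = H¹ f (a ∷ b ∷ w)
    + (ε a b * H (f ⟨ one a ⟩ ⟨ top a ⟩) w + o a b * - H (f ⟨ one a ⟩) (b ∷ w))

  Π : ∀ {k} → Cochain k → Cochain k
  Π f []          = f []
  Π f (a ∷ [])    = u a * f (one a ∷ [])
  Π f (a ∷ b ∷ w) = ε a b * Π (f ⟨ one a ⟩ ⟨ top a ⟩) w + o a b * Π (f ⟨ one a ⟩) (b ∷ w)

  δ-linear : ∀ {k} x y (f g : Cochain k) w → δ (λ v → x * f v + y * g v) w ≡ x * δ f w + y * δ g w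
  δ-linear x y f g (a ∷ []) = sym (trans (cong₂ _+_ (ℤ.*-zeroʳ x) (ℤ.*-zeroʳ y)) refl)
  δ-linear x y f g (a ∷ b ∷ w) =
    trans (cong (λ z → - (χ a b * (x * f (a ⊕ b ∷ w) + y * g (a ⊕ b ∷ w))) - z)
                (δ-linear x y (f ⟨ a ⟩) (g ⟨ a ⟩) (b ∷ w)))
          (lem x y (χ a b) (f (a ⊕ b ∷ w)) (g (a ⊕ b ∷ w)) _ _)
    where
    lem : ∀ x y c p q r s → - (c * (x * p + y * q)) - (x * r + y * s) ≡ x * (- (c * p) - r) + y * (- (c * q) - s)
    lem = solve-∀

  ≈ˢ⇒≡ : ∀ s t → True (s ≈ˢ t) → s ≡ t
  ≈ˢ⇒≡ true  true  _ = refl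
  ≈ˢ⇒≡ false false _ = refl

  xor⇒≡not : ∀ s t → True (s xor t) → t ≡ not s
  xor⇒≡not true  false _ = refl
  xor⇒≡not false true  _ = refl

  χ-cong : ∀ a b {p q : ℤ} → (proj₁ a ≡ proj₁ b → proj₂ a ℕ.+ proj₂ b < M → p ≡ q) → χ a b * p ≡ χ a b * q
  χ-cong (s , i) (t , j) h = ⟦⟧*⟦⟧-cong (s ≈ˢ t) _ λ st lt → h (≈ˢ⇒≡ s t st) (ℕ.<ᵇ⇒< _ _ lt)

  ε-cong : ∀ a b {p q : ℤ} → (proj₁ a ≡ proj₁ b → proj₂ a ℕ.+ proj₂ b ≡ M → p ≡ q) → ε a b * p ≡ ε a b * q
  ε-cong (s , i) (t , j) h = ⟦⟧*⟦⟧-cong (s ≈ˢ t) _ λ st eq → h (≈ˢ⇒≡ s t st) (ℕ.≡ᵇ⇒≡ _ _ eq)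

  o-cong : ∀ a b {p q : ℤ} → (proj₁ b ≡ not (proj₁ a) → proj₂ a ≡ 0 → p ≡ q) → o a b * p ≡ o a b * q
  o-cong (s , i) (t , j) h = ⟦⟧*⟦⟧-cong (s xor t) _ λ st eq → h (xor⇒≡not s t st) (ℕ.≡ᵇ⇒≡ _ _ eq)

  δ-local : ∀ {k} {f g : Cochain k} w → Valid w → (∀ v → Valid v → f v ≡ g v) → δ f w ≡ δ g w
  δ-local (a ∷ []) _ h = refl
  δ-local (a ∷ b ∷ w) (va ∷ vb ∷ vw) h =
    cong₂ (λ p q → - p - q) (χ-cong a b (λ _ lt → h _ (lt ∷ vw)))
      (δ-local (b ∷ w) (vb ∷ vw) (λ v vv → h (a ∷ v) (va ∷ vv)))

  δ-cong : ∀ {k} {f g : Cochain k} w → (∀ v → f v ≡ g v) → δ f w ≡ δ g w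
  δ-cong (a ∷ []) h = refl
  δ-cong (a ∷ b ∷ w) h =
    cong₂ (λ p q → - p - q) (cong (χ a b *_) (h _)) (δ-cong (b ∷ w) (λ v → h (a ∷ v)))

  δ-+ : ∀ {k} (f g : Cochain k) w → δ (λ v → f v + g v) w ≡ δ f w + δ g w
  δ-+ f g w = trans (δ-cong w (λ v → lem (f v) (g v))) (trans (δ-linear 1ℤ 1ℤ f g w) (sym (lem (δ f w) (δ g w))))
    where
    lem : ∀ p q → p + q ≡ 1ℤ * p + 1ℤ * q
    lem = solve-∀

  δ-* : ∀ {k} x (f : Cochain k) w → δ (λ v → x * f v) w ≡ x * δ f w
  δ-* x f w = trans (δ-cong w (λ v → lem x (f v))) (trans (δ-linear x 0ℤ f f w) (sym (lem x _)))
    where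
    lem : ∀ x p → x * p ≡ x * p + 0ℤ * p
    lem = solve-∀

  δ-0 : ∀ {k} w → δ {k} (λ _ → 0ℤ) w ≡ 0ℤ
  δ-0 w = trans (δ-linear 0ℤ 0ℤ (λ _ → 0ℤ) (λ _ → 0ℤ) w) refl

  H-linear : ∀ {k} x y (f g : Cochain (suc k)) w → H (λ v → x * f v + y * g v) w ≡ x * H f w + y * H g w
  H-linear x y f g [] = sym (cong₂ _+_ (ℤ.*-zeroʳ x) (ℤ.*-zeroʳ y))
  H-linear x y f g (a ∷ []) = lem x y (η a) _ _
    where
    lem : ∀ x y e p q → - (e * (x * p + y * q)) ≡ x * - (e * p) + y * - (e * q)
    lem = solve-∀
  H-linear x y f g (a ∷ b ∷ w) =
    trans (cong₂ (λ p q → H¹ (λ v → x * f v + y * g v) (a ∷ b ∷ w) + (ε a b * p + o a b * - q))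
             (H-linear x y (f ⟨ one a ⟩ ⟨ top a ⟩) (g ⟨ one a ⟩ ⟨ top a ⟩) w)
             (H-linear x y (f ⟨ one a ⟩) (g ⟨ one a ⟩) (b ∷ w)))
          (lem x y (η a) (ε a b) (o a b) _ _ _ _ _ _)
    where
    lem : ∀ x y e c d p q r s t v →
          - (e * (x * p + y * q)) + (c * (x * r + y * s) + d * - (x * t + y * v))
          ≡ x * (- (e * p) + (c * r + d * - t)) + y * (- (e * q) + (c * s + d * - v))
    lem = solve-∀

  H-cong : ∀ {k} {f g : Cochain (suc k)} w → (∀ v → f v ≡ g v) → H f w ≡ H g w
  H-cong []          h = refl
  H-cong (a ∷ [])    h = cong (λ p → - (η a * p)) (h (one a ∷ dec a ∷ []))
  H-cong (a ∷ b ∷ w) h = cong₂ _+_ (cong (λ p → - (η a * p)) (h (one a ∷ dec a ∷ b ∷ w)))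
    (cong₂ (λ p q → ε a b * p + o a b * - q) (H-cong w (λ v → h (one a ∷ top a ∷ v))) (H-cong (b ∷ w) (λ v → h (one a ∷ v))))

  Π-linear : ∀ {k} x y (f g : Cochain k) w → Π (λ v → x * f v + y * g v) w ≡ x * Π f w + y * Π g w
  Π-linear x y f g [] = refl
  Π-linear x y f g (a ∷ []) = lem x y (u a) _ _
    where
    lem : ∀ x y e p q → e * (x * p + y * q) ≡ x * (e * p) + y * (e * q)
    lem = solve-∀
  Π-linear x y f g (a ∷ b ∷ w) =
    trans (cong₂ (λ p q → ε a b * p + o a b * q)
             (Π-linear x y (f ⟨ one a ⟩ ⟨ top a ⟩) (g ⟨ one a ⟩ ⟨ top a ⟩) w)
             (Π-linear x y (f ⟨ one a ⟩) (g ⟨ one a ⟩) (b ∷ w)))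
          (lem x y (ε a b) (o a b) _ _ _ _)
    where
    lem : ∀ x y c d r s t v → c * (x * r + y * s) + d * (x * t + y * v) ≡ x * (c * r + d * t) + y * (c * s + d * v)
    lem = solve-∀

  SameHead : ∀ {j k} → Word j → Word k → Set
  SameHead (a ∷ _) (b ∷ _) = proj₁ a ≡ proj₁ b
  SameHead _       _       = ⊤

  total-pair : ∀ {i j t t′} → i ℕ.+ j ≡ M → t ≡ t′ → suc (suc M ℕ.+ t) ≡ suc (i ℕ.+ suc (j ℕ.+ t′))
  total-pair {i} {j} {t} refl refl = cong suc (trans (cong suc (ℕ.+-assoc i j t)) (sym (ℕ.+-suc i (j ℕ.+ t))))

  -- Each restriction on `v` has its use: validity for identities that hold on valid words only,
  -- `total` for keeping the chain homotopy inside one length grading, and the head direction for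
  -- recursion behind a unit, where a turn has to remain a turn.
  H-local : ∀ {k} {f g : Cochain (suc k)} w → Valid w →
            (∀ v → Valid v → total v ≡ total w → SameHead v w → f v ≡ g v) → H f w ≡ H g w
  H¹-local : ∀ {k} {f g : Cochain (suc (suc k))} w → Valid w →
            (∀ v → Valid v → total v ≡ total w → SameHead v w → f v ≡ g v) → H¹ f w ≡ H¹ g w
  H¹-local ((s , zero)  ∷ w) (va ∷ vw) h = refl
  H¹-local ((s , suc i) ∷ w) (va ∷ vw) h = cong (λ z → - (1ℤ * z))
    (h _ (z≤n ∷ ℕ.≤-trans (ℕ.n≤1+n i) va ∷ vw) refl refl)
  H-local [] _ h = refl
  H-local (a ∷ []) va h = H¹-local (a ∷ []) va h
  H-local {f = f} {g} (a ∷ b ∷ w) vw@(va ∷ vbw@(vb ∷ vw′)) h =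
    cong₂ _+_ (H¹-local (a ∷ b ∷ w) vw h)
      (cong₂ _+_ (ε-cong a b (λ _ eq → H-local w vw′ (λ v vv tv _ → h _ (z≤n ∷ ℕ.≤-refl ∷ vv) (total-pair eq tv) refl)))
                 (o-cong a b (λ _ eq → cong -_ (H-local (b ∷ w) vbw
                    (λ v vv tv _ → h _ (z≤n ∷ vv) (cong₂ (λ i t → suc i ℕ.+ t) (sym eq) tv) refl)))))

  one-step : ∀ n → ⟦ n <ᵇ M ⟧ ≡ ⟦ suc n <ᵇ M ⟧ + ⟦ suc n ≡ᵇ M ⟧
  one-step n = go n M
    where
    go : ∀ n M → ⟦ n <ᵇ M ⟧ ≡ ⟦ suc n <ᵇ M ⟧ + ⟦ suc n ≡ᵇ M ⟧
    go zero    zero          = refl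
    go zero    (suc zero)    = refl
    go zero    (suc (suc M)) = refl
    go (suc n) zero          = refl
    go (suc n) (suc M)       = go n M

  -- The partners gained by shortening a step are those that together with the original step have
  -- size m + 1. This is the defect that prevents `H¹` from contracting everything.
  χ-dec : ∀ s i b → χ (s , i) b ≡ χ (s , suc i) b + ε (s , suc i) b
  χ-dec s i (t , j) = trans (cong (⟦ s ≈ˢ t ⟧ *_) (one-step (i ℕ.+ j))) (ℤ.*-distribˡ-+ ⟦ s ≈ˢ t ⟧ _ _)

  χ-one : ∀ s i → i < M → χ (s , 0) (s , i) ≡ 1ℤ
  χ-one true  i lt = cong (1ℤ *_) (⟦T⟧ (ℕ.<⇒<ᵇ lt))
  χ-one false i lt = cong (1ℤ *_) (⟦T⟧ (ℕ.<⇒<ᵇ lt))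

  first-step₁ : ∀ (f : Cochain 1) a → Valid (a ∷ []) → f (a ∷ []) ≡ u a * f (one a ∷ []) + H¹ (δ f) (a ∷ [])
  first-step₁ f (s , zero)  _ = lem (f ((s , 0) ∷ [])) 0ℤ
    where
    lem : ∀ p q → p ≡ 1ℤ * p + - (0ℤ * q)
    lem = solve-∀
  first-step₁ f (s , suc i) (va ∷ []) rewrite χ-one s i va = lem (f ((s , suc i) ∷ [])) 0ℤ
    where
    lem : ∀ p q → p ≡ 0ℤ * q + - (1ℤ * (- (1ℤ * p) - 0ℤ))
    lem = solve-∀

  -- If the leading step has size at least 2, splitting and merging it returns `f w`. The faces that
  -- merge its second half with `b` cancel against `δ (H¹ f)` up to the `ε` of `χ-dec`, which `E`
  -- supplies. If it is a unit, `δ (H¹ f)` recovers `f w` when `b` can be merged with it; otherwise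
  -- `b` is a step of size m in the same direction or a turn, and these are the two summands of `E`.
  first-step : ∀ {k} (f : Cochain (suc (suc k))) w → Valid w →
    f w ≡ E (λ a → f ⟨ a ⟩ ⟨ top a ⟩) (λ a → f ⟨ a ⟩) w + H¹ (δ f) w + δ (H¹ f) w
  first-step f ((s , zero) ∷ b@(t , j) ∷ w) (va ∷ vb ∷ vw) =
    trans (split s t j vb) (trans (lem (ε (s , 0) b) (o (s , 0) b) (χ (s , 0) b)
        (f ((s , 0) ∷ (s , M) ∷ w)) (f ((s , 0) ∷ b ∷ w)) (f ((s , 0) ∷ (s , j) ∷ w)) 0ℤ)
     (cong (λ z → ε (s , 0) b * f ((s , 0) ∷ (s , M) ∷ w) + o (s , 0) b * f ((s , 0) ∷ b ∷ w)
        + - (0ℤ * δ f ((s , 0) ∷ (s , 0) ∷ b ∷ w)) + (- (χ (s , 0) b * - (1ℤ * f ((s , 0) ∷ (s , j) ∷ w))) - z))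
       (sym (trans (δ-cong (b ∷ w) (λ v → refl)) (δ-0 (b ∷ w))))))
    where
    lem : ∀ e o c p q r s → e * p + o * q + c * r ≡ e * p + o * q + - (0ℤ * s) + (- (c * - (1ℤ * r)) - 0ℤ)
    lem = solve-∀
    same : ∀ s j → j ≤ M → f ((s , 0) ∷ (s , j) ∷ w) ≡
      1ℤ * ⟦ j ≡ᵇ M ⟧ * f ((s , 0) ∷ (s , M) ∷ w) + 0ℤ * f ((s , 0) ∷ (s , j) ∷ w)
        + 1ℤ * ⟦ j <ᵇ M ⟧ * f ((s , 0) ∷ (s , j) ∷ w)
    same s j vb with j ℕ.≟ M
    ... | yes refl rewrite ⟦T⟧ (ℕ.≡⇒≡ᵇ M M refl) | ⟦¬T⟧ {M <ᵇ M} (λ p → ℕ.n≮n M (ℕ.<ᵇ⇒< M M p)) = lem′ (f ((s , 0) ∷ (s , M) ∷ w))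
      where
      lem′ : ∀ p → p ≡ 1ℤ * 1ℤ * p + 0ℤ * p + 1ℤ * 0ℤ * p
      lem′ = solve-∀
    ... | no j≢M rewrite ⟦¬T⟧ {j ≡ᵇ M} (λ p → j≢M (ℕ.≡ᵇ⇒≡ j M p)) | ⟦T⟧ (ℕ.<⇒<ᵇ (ℕ.≤∧≢⇒< vb j≢M)) = lem′ (f ((s , 0) ∷ (s , j) ∷ w)) 0ℤ
      where
      lem′ : ∀ p q → p ≡ 1ℤ * 0ℤ * q + 0ℤ * p + 1ℤ * 1ℤ * p
      lem′ = solve-∀
    opp : ∀ p → p ≡ 0ℤ + 1ℤ * p + 0ℤ
    opp = solve-∀
    split : ∀ s t j → j ≤ M → f ((s , 0) ∷ (t , j) ∷ w) ≡
      ε (s , 0) (t , j) * f ((s , 0) ∷ (s , M) ∷ w) + o (s , 0) (t , j) * f ((s , 0) ∷ (t , j) ∷ w)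
        + χ (s , 0) (t , j) * f ((s , 0) ∷ (s , j) ∷ w)
    split true  true  j vb = same true j vb
    split false false j vb = same false j vb
    split true  false j vb = opp (f ((true , 0) ∷ (false , j) ∷ w))
    split false true  j vb = opp (f ((false , 0) ∷ (true , j) ∷ w))
  first-step f (a@(s , suc i) ∷ b@(t , j) ∷ w) (va ∷ vb ∷ vw) rewrite χ-one s i va | χ-dec s i b | ℤ.*-zeroʳ ⟦ s xor t ⟧ =
    trans (lem (ε a b) (χ a b) (f (a ∷ b ∷ w)) (f ((s , 0) ∷ (s , suc (i ℕ.+ j)) ∷ w))
               (f ((s , 0) ∷ b ∷ w)) (δ (f ⟨ (s , 0) ⟩ ⟨ (s , i) ⟩) (b ∷ w)))
      (cong₂ (λ p q → p + 0ℤ * f ((s , 0) ∷ b ∷ w) +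
          - (1ℤ * (- (1ℤ * f (a ∷ b ∷ w)) - (- ((χ a b + ε a b) * f ((s , 0) ∷ (s , suc (i ℕ.+ j)) ∷ w)) -
          δ (f ⟨ (s , 0) ⟩ ⟨ (s , i) ⟩) (b ∷ w)))) + (- (χ a b * - (1ℤ * f ((s , 0) ∷ (s , suc (i ℕ.+ j)) ∷ w))) - q))
        -- Where `ε` is nonzero, the second half merged with `b` is precisely the step of size m
        -- that `E` puts behind the unit.
        (ε-cong a b (λ _ eq → cong (λ z → f ((s , 0) ∷ (s , z) ∷ w)) eq))
        (sym (trans (δ-cong (b ∷ w) (λ v → neg _)) (trans (δ-* (- 1ℤ) (f ⟨ (s , 0) ⟩ ⟨ (s , i) ⟩) (b ∷ w)) (neg′ _)))))
    where
    neg : ∀ p → - (1ℤ * p) ≡ - 1ℤ * p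
    neg = solve-∀
    neg′ : ∀ p → - 1ℤ * p ≡ - p
    neg′ = solve-∀
    lem : ∀ e c p q r d → p ≡ e * q + 0ℤ * r + - (1ℤ * (- (1ℤ * p) - (- ((c + e) * q) - d))) + (- (c * - (1ℤ * q)) - - d)
    lem = solve-∀

  +-suc-assoc : ∀ i j k → i ℕ.+ suc (j ℕ.+ k) ≡ suc (i ℕ.+ j) ℕ.+ k
  +-suc-assoc i j k = trans (ℕ.+-suc i (j ℕ.+ k)) (cong suc (sym (ℕ.+-assoc i j k)))

  -- Both sides indicate that three sizes add up to m + 1. Two of them then add up to at most m, so
  -- the first factor on either side is automatic.
  assoc-bracket : ∀ i j k → ⟦ i ℕ.+ j <ᵇ M ⟧ * ⟦ suc (i ℕ.+ j) ℕ.+ k ≡ᵇ M ⟧ ≡ ⟦ j ℕ.+ k <ᵇ M ⟧ * ⟦ i ℕ.+ suc (j ℕ.+ k) ≡ᵇ M ⟧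
  assoc-bracket i j k with suc (i ℕ.+ j) ℕ.+ k ℕ.≟ M
  ... | yes eq
    rewrite ⟦T⟧ (ℕ.≡⇒≡ᵇ _ _ eq) | ⟦T⟧ (ℕ.≡⇒≡ᵇ _ _ (trans (+-suc-assoc i j k) eq))
          | ⟦T⟧ (ℕ.<⇒<ᵇ {i ℕ.+ j} (subst (i ℕ.+ j <_) eq (s≤s (ℕ.m≤m+n _ k))))
          | ⟦T⟧ (ℕ.<⇒<ᵇ {j ℕ.+ k} (subst (j ℕ.+ k <_) (trans (+-suc-assoc i j k) eq) (ℕ.m≤n+m _ i))) = refl
  ... | no ≢M
    rewrite ⟦¬T⟧ {suc (i ℕ.+ j) ℕ.+ k ≡ᵇ M} (λ p → ≢M (ℕ.≡ᵇ⇒≡ _ _ p))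
          | ⟦¬T⟧ {i ℕ.+ suc (j ℕ.+ k) ≡ᵇ M} (λ p → ≢M (trans (sym (+-suc-assoc i j k)) (ℕ.≡ᵇ⇒≡ _ _ p))) =
    trans (ℤ.*-zeroʳ ⟦ i ℕ.+ j <ᵇ M ⟧) (sym (ℤ.*-zeroʳ ⟦ j ℕ.+ k <ᵇ M ⟧))

  ≈ˢ-cycle : ∀ s t r → ⟦ s ≈ˢ t ⟧ * ⟦ s ≈ˢ r ⟧ ≡ ⟦ t ≈ˢ r ⟧ * ⟦ s ≈ˢ t ⟧
  ≈ˢ-cycle true  true  true  = refl
  ≈ˢ-cycle true  true  false = refl
  ≈ˢ-cycle true  false true  = refl
  ≈ˢ-cycle true  false false = refl
  ≈ˢ-cycle false true  true  = refl
  ≈ˢ-cycle false true  false = refl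
  ≈ˢ-cycle false false true  = refl
  ≈ˢ-cycle false false false = refl

  χε-assoc : ∀ a b c → χ a b * ε (a ⊕ b) c ≡ χ b c * ε a (b ⊕ c)
  χε-assoc (s , i) (t , j) (r , k) =
    trans (swap ⟦ s ≈ˢ t ⟧ ⟦ i ℕ.+ j <ᵇ M ⟧ ⟦ s ≈ˢ r ⟧ ⟦ suc (i ℕ.+ j) ℕ.+ k ≡ᵇ M ⟧)
      (trans (cong₂ _*_ (≈ˢ-cycle s t r) (assoc-bracket i j k))
        (swap ⟦ t ≈ˢ r ⟧ ⟦ s ≈ˢ t ⟧ ⟦ j ℕ.+ k <ᵇ M ⟧ ⟦ i ℕ.+ suc (j ℕ.+ k) ≡ᵇ M ⟧))
    where
    swap : ∀ p q r s → p * q * (r * s) ≡ p * r * (q * s)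
    swap = solve-∀

  o-⊕ : ∀ a b c → o (a ⊕ b) c ≡ 0ℤ
  o-⊕ (s , i) (t , j) (r , k) = ℤ.*-zeroʳ ⟦ s xor r ⟧

  -- Faces reaching into the prefix do no harm: the two ways of merging a triple of total size m + 1
  -- into a pair have opposite signs and cancel by `χε-assoc`, and a merged first step is never a
  -- unit, so it contributes nothing to the `o` summand. The signs + and - come from passing two
  -- letters and one letter.
  δE : ∀ {k} (g₁ : Letter → Cochain k) (g₂ : Letter → Cochain (suc k)) w →
       δ (E g₁ g₂) w ≡ E (λ a → δ (g₁ a)) (λ a v → - δ (g₂ a) v) w
  δE g₁ g₂ (a ∷ b ∷ c ∷ w)
    rewrite δ-linear (ε a b) (o a b) (g₁ (one a)) (g₂ (one a) ⟨ b ⟩) (c ∷ w) | o-⊕ a b c =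
    trans (lem (χ a b) (ε (a ⊕ b) c) (g₁ (one a) w) (g₂ (one a) (c ∷ w)) tail)
      (trans (cong (λ z → - (z * g₁ (one a) w) - tail) (χε-assoc a b c))
        (lem₂ (χ b c) (ε a (b ⊕ c)) (ε a b) (o a b) (g₁ (one a) w) (g₂ (one a) (b ⊕ c ∷ w))
              (δ (g₁ (one a)) (c ∷ w)) (δ (g₂ (one a) ⟨ b ⟩) (c ∷ w))))
    where
    tail = - (χ b c * (ε a (b ⊕ c) * g₁ (one a) w + o a b * g₂ (one a) (b ⊕ c ∷ w)))
             - (ε a b * δ (g₁ (one a)) (c ∷ w) + o a b * δ (g₂ (one a) ⟨ b ⟩) (c ∷ w))
    lem : ∀ x e p q r → - (x * (e * p + 0ℤ * q)) - r ≡ - (x * e * p) - r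
    lem = solve-∀
    lem₂ : ∀ x e e′ o p q r s → - (x * e * p) - (- (x * (e * p + o * q)) - (e′ * r + o * s))
             ≡ e′ * r + o * - (- (x * q) - s)
    lem₂ = solve-∀

  δΠ : ∀ {k} (f : Cochain k) w → δ (Π f) w ≡ 0ℤ
  δΠ f (a ∷ []) = refl
  δΠ f (a ∷ b ∷ []) = lem (χ a b)
    where
    lem : ∀ x → - (x * 0ℤ) - 0ℤ ≡ 0ℤ
    lem = solve-∀
  δΠ f (a ∷ b ∷ c ∷ w) =
    trans (δ-cong {f = Π f} {g = E (λ x → Π (f ⟨ x ⟩ ⟨ top x ⟩)) (λ x → Π (f ⟨ x ⟩))} (a ∷ b ∷ c ∷ w) λ { (_ ∷ _ ∷ _) → refl })
      (trans (δE (λ x → Π (f ⟨ x ⟩ ⟨ top x ⟩)) (λ x → Π (f ⟨ x ⟩)) (a ∷ b ∷ c ∷ w))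
        (trans (cong₂ (λ p q → ε a b * p + o a b * - q) (δΠ (f ⟨ one a ⟩ ⟨ top a ⟩) (c ∷ w)) (δΠ (f ⟨ one a ⟩) (b ∷ c ∷ w)))
           (lem (ε a b) (o a b))))
    where
    lem : ∀ p q → p * 0ℤ + q * - 0ℤ ≡ 0ℤ
    lem = solve-∀

  <ᵇ-irrefl : ∀ i → ⟦ i ℕ.+ M <ᵇ M ⟧ ≡ 0ℤ
  <ᵇ-irrefl i = ⟦¬T⟧ {i ℕ.+ M <ᵇ M} (λ p → ℕ.n≮n M (ℕ.≤-trans (s≤s (ℕ.m≤n+m M i)) (ℕ.<ᵇ⇒< _ M p)))

  χ-topˡ : ∀ s b → χ (s , M) b ≡ 0ℤ
  χ-topˡ s (t , j) rewrite ℕ.+-comm M j | <ᵇ-irrefl j = ℤ.*-zeroʳ ⟦ s ≈ˢ t ⟧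

  χ-topʳ : ∀ a t → χ a (t , M) ≡ 0ℤ
  χ-topʳ (s , i) t rewrite <ᵇ-irrefl i = ℤ.*-zeroʳ ⟦ s ≈ˢ t ⟧

  -- A step of size m merges with neither neighbour, so all faces lie behind the pair; passing its
  -- two letters costs no sign.
  δ-top : ∀ {k} (f : Cochain (suc (suc k))) s v → δ f ((s , 0) ∷ (s , M) ∷ v) ≡ δ (f ⟨ (s , 0) ⟩ ⟨ (s , M) ⟩) v
  δ-top f s (b ∷ v) rewrite χ-topʳ (s , 0) s | χ-topˡ s b = lem (δ (f ⟨ (s , 0) ⟩ ⟨ (s , M) ⟩) (b ∷ v))
    where
    lem : ∀ r → 0ℤ - (0ℤ - r) ≡ r
    lem = solve-∀

  χ-opp : ∀ s i j → χ (s , i) (not s , j) ≡ 0ℤ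
  χ-opp true  i j = refl
  χ-opp false i j = refl

  δ-opp : ∀ {k} (f : Cochain (suc k)) s j v → δ f ((s , 0) ∷ (not s , j) ∷ v) ≡ - δ (f ⟨ (s , 0) ⟩) ((not s , j) ∷ v)
  δ-opp f s j v rewrite χ-opp s 0 j = ℤ.+-identityˡ _

  H-neg : ∀ {k} (f : Cochain (suc k)) w → Valid w → H (λ v → - f v) w ≡ - H f w
  H-neg f w vw = trans (H-local w vw (λ v _ _ _ → lem (f v))) (trans (H-linear (- 1ℤ) 0ℤ f f w) (sym (lem _)))
    where
    lem : ∀ p → - p ≡ - 1ℤ * p + 0ℤ * p
    lem = solve-∀

  -- The sign in the definition of `H` meets the sign of `δ` in passing the unit. `δ-opp` is
  -- available only for words that start against the unit, and by `H-local` the operator consults no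
  -- others.
  Hδ-opp : ∀ {k} (f : Cochain (suc (suc k))) a b (w : Word k) → Valid (b ∷ w) →
    o a b * - H (δ f ⟨ one a ⟩) (b ∷ w) ≡ o a b * H (δ (f ⟨ one a ⟩)) (b ∷ w)
  Hδ-opp f a@(s , _) b w vbw = o-cong a b λ { refl _ →
    trans (cong -_ (trans (H-local (b ∷ w) vbw λ { ((_ , j) ∷ v) _ _ refl → δ-opp f s j v })
                          (H-neg (δ (f ⟨ one a ⟩)) (b ∷ w) vbw)))
          (ℤ.neg-involutive _) }

  contraction₀ : ∀ (f : Cochain 0) w → f w ≡ Π f w + H (δ f) w
  contraction₀ f [] = sym (ℤ.+-identityʳ _)

  -- The summands of `E` in `first-step` evaluate `f` on shorter remainders, to which induction
  -- applies; `δ-top`, `Hδ-opp` and `δE` move the resulting differentials back in front of the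
  -- prefix.
  contraction : ∀ {k} (f : Cochain (suc k)) w → Valid w → f w ≡ Π f w + H (δ f) w + δ (H f) w
  contraction f (a ∷ []) va = trans (first-step₁ f a va) (sym (ℤ.+-identityʳ _))
  -- Behind a pair the remainder is empty here, and the identity for the empty word has no `δ H`
  -- term.
  contraction f (a ∷ b ∷ []) vw@(va ∷ vb@(_ ∷ [])) =
    trans (first-step f (a ∷ b ∷ []) vw)
    (trans (cong (λ z → ε a b * f₁ₘ [] + o a b * z + H¹ (δ f) (a ∷ b ∷ []) + δ (H¹ f) (a ∷ b ∷ []))
              (contraction f₁ (b ∷ []) vb))
    (trans (lem (ε a b) (o a b) (f₁ₘ []) (Π f₁ (b ∷ [])) (H (δ f₁) (b ∷ [])) _ _)
     (cong (λ z → ε a b * f₁ₘ [] + o a b * Π f₁ (b ∷ []) + (H¹ (δ f) (a ∷ b ∷ []) + (ε a b * 0ℤ + z)) + δ (H¹ f) (a ∷ b ∷ []))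
        (sym (Hδ-opp f a b [] vb)))))
    where
    f₁  = f ⟨ one a ⟩
    f₁ₘ = f ⟨ one a ⟩ ⟨ top a ⟩
    lem : ∀ e o p q r s t → e * p + o * (q + r + 0ℤ) + s + t ≡ e * p + o * q + (s + (e * 0ℤ + o * r)) + t
    lem = solve-∀
  contraction f w₀@(a ∷ b ∷ c ∷ w) vw@(va ∷ vb@(_ ∷ vc)) =
    trans (first-step f w₀ vw)
    (trans (cong₂ (λ y z → ε a b * y + o a b * z + H¹ (δ f) w₀ + δ (H¹ f) w₀)
              (contraction f₁ₘ (c ∷ w) vc) (contraction f₁ (b ∷ c ∷ w) vb))
    (trans (lem (ε a b) (o a b) (Π f₁ₘ (c ∷ w)) (H (δ f₁ₘ) (c ∷ w)) (δ (H f₁ₘ) (c ∷ w))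
                (Π f₁ (b ∷ c ∷ w)) (H (δ f₁) (b ∷ c ∷ w)) (δ (H f₁) (b ∷ c ∷ w)) _ _)
     (cong₂ (λ y z → Π f w₀ + y + z)
       (cong (H¹ (δ f) w₀ +_) (cong₂ (λ y z → ε a b * y + z)
         (H-local (c ∷ w) vc (λ v _ _ _ → sym (δ-top f (proj₁ a) v)))
         (sym (Hδ-opp f a b (c ∷ w) vb))))
       (sym δH))))
    where
    f₁  = f ⟨ one a ⟩
    f₁ₘ = f ⟨ one a ⟩ ⟨ top a ⟩
    lem : ∀ e o p q r p′ q′ r′ s t → e * (p + q + r) + o * (p′ + q′ + r′) + s + t
            ≡ e * p + o * p′ + (s + (e * q + o * q′)) + (t + (e * r + o * - - r′))
    lem = solve-∀
    neg : ∀ p → - p ≡ - 1ℤ * p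
    neg = solve-∀
    δ-neg : ∀ {k} (g : Cochain k) v → δ (λ v → - g v) v ≡ - δ g v
    δ-neg g v = trans (δ-cong v (λ v → neg (g v))) (trans (δ-* (- 1ℤ) g v) (sym (neg _)))
    δH : δ (H f) w₀ ≡ δ (H¹ f) w₀ + (ε a b * δ (H f₁ₘ) (c ∷ w) + o a b * - - δ (H f₁) (b ∷ c ∷ w))
    δH = trans (δ-cong {f = H f} {g = λ v → H¹ f v + E (λ x → H (f ⟨ x ⟩ ⟨ top x ⟩)) (λ x v → - H (f ⟨ x ⟩) v) v} w₀
           λ { (_ ∷ _ ∷ _) → refl })
         (trans (δ-+ (H¹ f) (E (λ x → H (f ⟨ x ⟩ ⟨ top x ⟩)) (λ x v → - H (f ⟨ x ⟩) v)) w₀)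
         (cong (δ (H¹ f) w₀ +_)
           (trans (δE (λ x → H (f ⟨ x ⟩ ⟨ top x ⟩)) (λ x v → - H (f ⟨ x ⟩) v) w₀)
             (cong (λ z → ε a b * δ (H f₁ₘ) (c ∷ w) + o a b * - z) (δ-neg (H f₁) (b ∷ c ∷ w))))))

  -- Critical words

  data Crit : ∀ {k} → Word k → Set where
    nil    : Crit []
    single : ∀ {s} → Crit ((s , 0) ∷ [])
    pair   : ∀ {s k} {w : Word k} → Crit w → Crit ((s , 0) ∷ (s , M) ∷ w)
    turn   : ∀ {s j k} {w : Word k} → Crit ((not s , j) ∷ w) → Crit ((s , 0) ∷ (not s , j) ∷ w)

  crit-valid : ∀ {k} {w : Word k} → Crit w → Valid w
  crit-valid nil      = []
  crit-valid single   = z≤n ∷ []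
  crit-valid (pair c) = z≤n ∷ ℕ.≤-refl ∷ crit-valid c
  crit-valid (turn c) = z≤n ∷ crit-valid c

  δ-crit : ∀ {k} (f : Cochain k) {w} → Crit w → δ f w ≡ 0ℤ
  δ-crit f single = refl
  δ-crit f (pair {s} {w = []} c) rewrite χ-topʳ (s , 0) s = refl
  δ-crit f (pair {s} {w = b ∷ w} c) = trans (δ-top f s (b ∷ w)) (δ-crit (f ⟨ (s , 0) ⟩ ⟨ (s , M) ⟩) c)
  δ-crit f (turn {s} {j} {w = w} c) = trans (δ-opp f s j w) (cong -_ (δ-crit (f ⟨ (s , 0) ⟩) c))

  Π-crit : ∀ {k} (f : Cochain k) {w} → Crit w → Π f w ≡ f w
  Π-crit f nil = refl
  Π-crit f single = ℤ.*-identityˡ _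
  Π-crit f (pair {s} {w = w} c)
    rewrite ⟦T⟧ (ℕ.≡⇒≡ᵇ M M refl) | Π-crit (f ⟨ (s , 0) ⟩ ⟨ (s , M) ⟩) c = same s (f ((s , 0) ∷ (s , M) ∷ w))
    where
    lem : ∀ p → 1ℤ * p + 0ℤ ≡ p
    lem = solve-∀
    same : ∀ s {q} p → ⟦ s ≈ˢ s ⟧ * 1ℤ * p + ⟦ s xor s ⟧ * 1ℤ * q ≡ p
    same true  = lem
    same false = lem
  Π-crit f (turn {s} {j} {w = w} c) rewrite Π-crit (f ⟨ (s , 0) ⟩) c = opp s (f ((s , 0) ∷ (not s , j) ∷ w))
    where
    lem : ∀ q → 0ℤ + 1ℤ * q ≡ q
    lem = solve-∀
    opp : ∀ s {x p} q → ⟦ s ≈ˢ not s ⟧ * x * p + ⟦ s xor not s ⟧ * 1ℤ * q ≡ q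
    opp true  = lem
    opp false = lem

  turn′ : ∀ {s t j k} {w : Word k} → t ≡ not s → Crit ((t , j) ∷ w) → Crit ((s , 0) ∷ (t , j) ∷ w)
  turn′ refl = turn

  -- The direction clause is what makes the induction close: it guarantees that a unit put in front
  -- of the critical remainder still precedes a turn, so the longer word is critical too.
  Π-local : ∀ {k} {f g : Cochain k} w →
            (∀ v → Crit v → total v ≡ total w → SameHead v w → f v ≡ g v) → Π f w ≡ Π g w
  Π-local [] h = h [] nil refl tt
  Π-local ((s , zero) ∷ []) h = cong (1ℤ *_) (h _ single refl refl)
  Π-local ((s , suc i) ∷ []) h = refl
  Π-local (a ∷ b ∷ w) h =
    cong₂ _+_ (ε-cong a b (λ _ eq → Π-local w (λ v cv tv _ → h _ (pair cv) (total-pair eq tv) refl)))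
              (o-cong a b (λ opp eq → Π-local (b ∷ w)
                 (λ { (_ ∷ v) cv tv hd → h _ (turn′ (trans hd opp) cv) (cong₂ (λ i t → suc i ℕ.+ t) (sym eq) tv) refl })))

  -- Enumeration of the critical words

  starting : Bool → ∀ k → ℕ → List (Word k)
  -- The words that may follow a pair, where the direction is free again. A pair has total m + 1,
  -- that is `suc (suc M)`; the guard in `starting` keeps truncated subtraction from turning too
  -- small a total into 0.
  fresh    : ∀ k → ℕ → List (Word k)

  starting s zero          l             = []
  starting s (suc k)       zero          = []
  starting s (suc zero)    (suc zero)    = ((s , 0) ∷ []) ∷ []
  starting s (suc zero)    (suc (suc l)) = []
  starting s (suc (suc k)) (suc l)       =
    map (λ w → (s , 0) ∷ (s , M) ∷ w) (if suc (suc M) ≤ᵇ suc l then fresh k (l ∸ suc M) else [])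
    ++ map ((s , 0) ∷_) (starting (not s) (suc k) l)

  fresh zero    zero    = [] ∷ []
  fresh zero    (suc l) = []
  fresh (suc k) l       = starting true (suc k) l ++ starting false (suc k) l

  HeadSign : Bool → ∀ {k} → Word k → Set
  HeadSign s []      = ⊥
  HeadSign s (a ∷ _) = proj₁ a ≡ s

  ∈-if⁻ : ∀ {A : Set} b {xs : List A} {x} → x ∈ (if b then xs else []) → True b × x ∈ xs
  ∈-if⁻ true p = tt , p

  ∈-if⁺ : ∀ {A : Set} b {xs : List A} {x} → True b → x ∈ xs → x ∈ (if b then xs else [])
  ∈-if⁺ true _ p = p

  starting-sound : ∀ s k l {w} → w ∈ starting s k l → Crit w × total w ≡ l × HeadSign s w
  fresh-sound    : ∀ k l {w} → w ∈ fresh k l → Crit w × total w ≡ l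

  starting-sound s (suc zero)    (suc zero) (here refl) = single , refl , refl
  starting-sound s (suc (suc k)) (suc l) p with ∈-++⁻ (map _ (if suc (suc M) ≤ᵇ suc l then fresh k (l ∸ suc M) else [])) p
  ... | inj₁ q with ∈-map⁻ _ q
  ...   | w , w∈ , refl with ∈-if⁻ (suc (suc M) ≤ᵇ suc l) w∈
  ...     | M<l , w∈′ with fresh-sound k (l ∸ suc M) w∈′
  ...       | c , eq = pair c , cong suc (trans (cong (suc M ℕ.+_) eq) (ℕ.m+[n∸m]≡n (ℕ.s≤s⁻¹ (ℕ.≤ᵇ⇒≤ (suc (suc M)) (suc l) M<l)))) , refl
  starting-sound s (suc (suc k)) (suc l) p | inj₂ q with ∈-map⁻ _ q
  ... | w , w∈ , refl with starting-sound (not s) (suc k) l w∈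
  starting-sound s (suc (suc k)) (suc l) p | inj₂ q | (.(not s) , j) ∷ w , w∈ , refl | c , eq , refl = turn c , cong suc eq , refl

  fresh-sound zero    zero    (here refl) = nil , refl
  fresh-sound (suc k) l p with ∈-++⁻ (starting true (suc k) l) p
  ... | inj₁ q = let c , eq , _ = starting-sound true  (suc k) l q in c , eq
  ... | inj₂ q = let c , eq , _ = starting-sound false (suc k) l q in c , eq

  starting-complete : ∀ {k s i} {w : Word k} l → Crit ((s , i) ∷ w) → total ((s , i) ∷ w) ≡ l → ((s , i) ∷ w) ∈ starting s (suc k) l
  fresh-complete    : ∀ {k} {w : Word k} l → Crit w → total w ≡ l → w ∈ fresh k l

  starting-complete _ single refl = here refl
  starting-complete _ (pair {s} {w = w} c) refl = ∈-++⁺ˡ (∈-map⁺ _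
    (∈-if⁺ _ (ℕ.≤⇒≤ᵇ (s≤s (ℕ.m≤m+n (suc M) (total w)))) (fresh-complete _ c (sym (ℕ.m+n∸m≡n (suc M) (total w))))))
  starting-complete {suc k} _ (turn {s} {j} {w = w} c) refl =
    ∈-++⁺ʳ (map _ (if suc (suc M) ≤ᵇ suc (suc j ℕ.+ total w) then fresh k ((suc j ℕ.+ total w) ∸ suc M) else []))
       (∈-map⁺ ((s , 0) ∷_) (starting-complete _ c refl))

  fresh-complete {w = []} zero nil _ = here refl
  fresh-complete {w = (true  , i) ∷ w} l c eq = ∈-++⁺ˡ (starting-complete l c eq)
  fresh-complete {suc k} {w = (false , i) ∷ w} l c eq = ∈-++⁺ʳ (starting true (suc k) l) (starting-complete l c eq)

  Unique-if : ∀ {A : Set} b {xs : List A} → Unique xs → Unique (if b then xs else [])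
  Unique-if true  p = p
  Unique-if false p = AllPairs.[]

  starting-unique : ∀ s k l → Unique (starting s k l)
  fresh-unique    : ∀ k l → Unique (fresh k l)

  starting-unique s zero          l             = AllPairs.[]
  starting-unique s (suc zero)    zero          = AllPairs.[]
  starting-unique s (suc (suc k)) zero          = AllPairs.[]
  starting-unique s (suc zero)    (suc zero)    = ListAll.[] AllPairs.∷ AllPairs.[]
  starting-unique s (suc zero)    (suc (suc l)) = AllPairs.[]
  starting-unique s (suc (suc k)) (suc l)       =
    Unique.++⁺ (Unique.map⁺ (λ eq → ∷-injectiveʳ (∷-injectiveʳ eq)) (Unique-if (suc (suc M) ≤ᵇ suc l) (fresh-unique k (l ∸ suc M))))
               (Unique.map⁺ ∷-injectiveʳ (starting-unique (not s) (suc k) l))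
               (λ (p , q) → disjoint (∈-map⁻ _ p) (∈-map⁻ _ q))
    where
    disjoint : ∀ {v} {xs : List (Word k)} → ∃ (λ w → w ∈ xs × v ≡ (s , 0) ∷ (s , M) ∷ w) →
               ∃ (λ w → w ∈ starting (not s) (suc k) l × v ≡ (s , 0) ∷ w) → ⊥
    disjoint (w , _ , refl) (w′ , w′∈ , refl) = not-¬ refl (proj₂ (proj₂ (starting-sound (not s) (suc k) l w′∈)))

  fresh-unique zero    zero    = ListAll.[] AllPairs.∷ AllPairs.[]
  fresh-unique zero    (suc l) = AllPairs.[]
  fresh-unique (suc k) l       = Unique.++⁺ (starting-unique true (suc k) l) (starting-unique false (suc k) l)
    (λ (p , q) → disjoint (proj₂ (proj₂ (starting-sound true (suc k) l p))) (proj₂ (proj₂ (starting-sound false (suc k) l q))))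
    where
    disjoint : ∀ {k} {w : Word (suc k)} → HeadSign true w → HeadSign false w → ⊥
    disjoint {w = _ ∷ _} refl ()

  length-if : ∀ {A : Set} b (xs : List A) → length (if b then xs else []) ≡ (if b then length xs else 0)
  length-if true  xs = refl
  length-if false xs = refl

  length-starting : ∀ s k l → length (starting s (suc (suc k)) (suc l)) ≡
    (if suc (suc M) ≤ᵇ suc l then length (fresh k (l ∸ suc M)) else 0) ℕ.+ length (starting (not s) (suc k) l)
  length-starting s k l = trans (length-++ (map _ (if suc (suc M) ≤ᵇ suc l then fresh k (l ∸ suc M) else [])))
    (cong₂ ℕ._+_ (trans (length-map _ (if suc (suc M) ≤ᵇ suc l then fresh k (l ∸ suc M) else []))
                        (length-if (suc (suc M) ≤ᵇ suc l) (fresh k (l ∸ suc M))))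
                 (length-map _ (starting (not s) (suc k) l)))

  length-starting-not : ∀ s k l → length (starting s k l) ≡ length (starting (not s) k l)
  length-starting-not s zero          l             = refl
  length-starting-not s (suc zero)    zero          = refl
  length-starting-not s (suc (suc k)) zero          = refl
  length-starting-not s (suc zero)    (suc zero)    = refl
  length-starting-not s (suc zero)    (suc (suc l)) = refl
  length-starting-not s (suc (suc k)) (suc l)       =
    trans (length-starting s k l) (trans (cong (_ ℕ.+_) (length-starting-not (not s) (suc k) l)) (sym (length-starting (not s) k l)))

  length-fresh : ∀ k l → length (fresh (suc k) l) ≡ 2 ℕ.* length (starting true (suc k) l)
  length-fresh k l = trans (length-++ (starting true (suc k) l))
    (cong (length (starting true (suc k) l) ℕ.+_) (trans (length-starting-not false (suc k) l) (sym (ℕ.+-identityʳ _))))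

  if-* : ∀ b n x → (if b then n ℕ.* x else 0) ≡ n ℕ.* (if b then x else 0)
  if-* true  n x = refl
  if-* false n x = sym (ℕ.*-zeroʳ n)

  -- Let S count the words with prescribed direction and F all of them. Then S(k,l) = F(k-2,
  -- l-(m+1)) + S(k-1, l-1) for k at least 2, and F = 2S in positive degree, which is the recursion
  -- for T after doubling. The empty word has no direction, so doubling fails in degree 0; this is
  -- why T(1,1) is an initial value. The outer factor counts starting vertices.
  length-T : ∀ k l → (2 ℕ.* suc M ℕ.+ 1) ℕ.* length (fresh k l) ≡ T (suc M) k l
  length-T zero          zero          = ℕ.*-identityʳ _
  length-T zero          (suc l)       = ℕ.*-zeroʳ (2 ℕ.* suc M ℕ.+ 1)
  length-T (suc zero)    zero          = ℕ.*-zeroʳ (2 ℕ.* suc M ℕ.+ 1)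
  length-T (suc zero)    (suc zero)    = lem M
    where
    lem : ∀ M → (2 ℕ.* suc M ℕ.+ 1) ℕ.* 2 ≡ 4 ℕ.* suc M ℕ.+ 2
    lem = solve-∀ᴺ
  length-T (suc zero)    (suc (suc l)) = ℕ.*-zeroʳ (2 ℕ.* suc M ℕ.+ 1)
  length-T (suc (suc k)) zero          = ℕ.*-zeroʳ (2 ℕ.* suc M ℕ.+ 1)
  length-T (suc (suc k)) (suc l)       = begin
    n ℕ.* length (fresh (suc (suc k)) (suc l))
      ≡⟨ cong (n ℕ.*_) (trans (length-fresh (suc k) (suc l)) (cong (2 ℕ.*_)
           (trans (length-starting true k l) (cong (x ℕ.+_) (sym (length-starting-not true (suc k) l)))))) ⟩
    n ℕ.* (2 ℕ.* (x ℕ.+ length (starting true (suc k) l)))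
      ≡⟨ lem n x _ ⟩
    n ℕ.* (2 ℕ.* length (starting true (suc k) l)) ℕ.+ 2 ℕ.* (n ℕ.* x)
      ≡⟨ cong₂ (λ p q → p ℕ.+ 2 ℕ.* q) (trans (cong (n ℕ.*_) (sym (length-fresh k l))) (length-T (suc k) l))
           (trans (sym (if-* b n _)) (cong (λ z → if b then z else 0) (length-T k (l ∸ suc M)))) ⟩
    T (suc M) (suc (suc k)) (suc l) ∎
    where
    open ≡-Reasoning
    n = 2 ℕ.* suc M ℕ.+ 1
    b = suc (suc M) ≤ᵇ suc l
    x = if b then length (fresh k (l ∸ suc M)) else 0
    lem : ∀ n x y → n ℕ.* (2 ℕ.* (x ℕ.+ y)) ≡ n ℕ.* (2 ℕ.* y) ℕ.+ 2 ℕ.* (n ℕ.* x)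
    lem = solve-∀ᴺ

  -- Tuples of vertices as words

  -- The argument is chosen so that its successor is the normal form of `2 * suc M + 1`; the results
  -- then apply to the stated graph without transport.
  open CycleGraph (M ℕ.+ (suc M ℕ.+ 0) ℕ.+ 1)
  open Graph n (cycleAdj n)
  open Faces n (cycleAdj n)

  n≡ : n ≡ suc (suc M ℕ.+ suc M)
  n≡ = cong suc (trans (ℕ.+-comm (M ℕ.+ (suc M ℕ.+ 0)) 1) (cong (λ r → suc (M ℕ.+ r)) (ℕ.+-identityʳ (suc M))))

  -- Excludes antipodal vertices: two short runs in opposite directions between the same distinct
  -- vertices would add up to n.
  short+short<n : ∀ {r r′} → r ≤ suc M → r′ ≤ suc M → r ℕ.+ r′ < n
  short+short<n {r} {r′} p q = subst (r ℕ.+ r′ <_) (sym n≡) (s≤s (ℕ.+-mono-≤ p q))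

  short<n : ∀ {r} → r ≤ suc M → r < n
  short<n {r} p = ℕ.≤-<-trans (ℕ.m≤m+n r 0) (short+short<n p z≤n)

  complement-short : ∀ {r} → suc M < r → n ∸ r ≤ suc M
  complement-short {r} lt = ℕ.≤-trans (ℕ.∸-monoʳ-≤ n lt) (ℕ.≤-reflexive (trans (cong (_∸ suc (suc M)) n≡) (ℕ.m+n∸m≡n (suc M) (suc M))))

  short-opposite : ∀ s {r r′ x y} → r ≤ suc M → r′ ≤ suc M → Step s r x y → Step (not s) r′ x y → r ≡ 0
  short-opposite s r≤ r′≤ p q with step-opposite s (short<n r≤) (short<n r′≤) p q
  ... | inj₁ r≡0 = r≡0
  ... | inj₂ eq  = contradiction eq (ℕ.<⇒≢ (short+short<n r≤ r′≤))

  same-or-not : ∀ s t → t ≡ s ⊎ t ≡ not s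
  same-or-not true  true  = inj₁ refl
  same-or-not true  false = inj₂ refl
  same-or-not false true  = inj₂ refl
  same-or-not false false = inj₁ refl

  dist-step : ∀ s {r x y} → r ≤ suc M → Step s r x y → dist x y ≡ r
  dist-step s {r} {x} {y} r≤ st = dist-least n (cycleAdj n) x y r (ℕ.<⇒≤ (short<n r≤))
    (within-complete s r x y (ℕ.<⇒≤ (short<n r≤)) st) miss
    where
    miss : ∀ k → k < r → ¬ True (within k x y)
    miss k k<r p with within-sound k x y (ℕ.<-trans k<r (short<n r≤)) p
    ... | t , r′ , r′≤k , st′ with same-or-not s t
    ...   | inj₁ refl = ℕ.<⇒≢ (ℕ.≤-<-trans r′≤k k<r)
                          (step-unique s (short<n (ℕ.≤-trans r′≤k (ℕ.≤-trans (ℕ.<⇒≤ k<r) r≤))) (short<n r≤) st′ st)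
    ...   | inj₂ refl with short-opposite s r≤ (ℕ.≤-trans r′≤k (ℕ.≤-trans (ℕ.<⇒≤ k<r) r≤)) st st′
    ...     | refl = contradiction k<r λ ()

  Step′ : Letter → V → V → Set
  Step′ a = Step (proj₁ a) (size a)

  move : V → Letter → V
  move x (true  , i) = next^ (suc i) x
  move x (false , i) = next^ (n ∸ suc i) x

  step-move : ∀ x a → proj₂ a ≤ M → Step′ a x (move x a)
  step-move x (true  , i) le = refl
  step-move x (false , i) le = next^-inverse′ (suc i) x (ℕ.<⇒≤ (short<n (s≤s le)))

  -- On equal vertices this yields the forward unit as a default; chains in `InMC` vanish on such
  -- tuples.
  disp : V → V → Letter
  disp x y = if gap x y ≤ᵇ suc M then (true , pred (gap x y)) else (false , pred (n ∸ gap x y))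

  step-disp : ∀ x y → x ≢ y → Step′ (disp x y) x y × proj₂ (disp x y) ≤ M
  step-disp x y x≢y with gap x y | next^-gap x y | gap<n x y
  ... | zero  | eq | _   = contradiction eq x≢y
  ... | suc g | eq | g<n with suc g ≤ᵇ suc M in le
  ...   | true  = eq , ℕ.s≤s⁻¹ (ℕ.≤ᵇ⇒≤ (suc g) (suc M) (subst True (sym le) tt))
  ...   | false = subst (λ r → Step false r x y) n∸g≡ (step-not true (ℕ.<⇒≤ g<n) eq) ,
                  ℕ.s≤s⁻¹ (subst (_≤ suc M) n∸g≡ (complement-short (ℕ.≰⇒> {suc g} λ p → subst True le (ℕ.≤⇒≤ᵇ p))))
    where
    n∸g≡ : n ∸ suc g ≡ suc (pred (n ∸ suc g))
    n∸g≡ = sym (ℕ.suc-pred (n ∸ suc g) {{ℕ.>-nonZero (ℕ.m<n⇒0<n∸m g<n)}})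

  letter-unique : ∀ {x y} a b → proj₂ a ≤ M → proj₂ b ≤ M → Step′ a x y → Step′ b x y → a ≡ b
  letter-unique (s , i) (t , j) i≤ j≤ p q with same-or-not s t
  ... | inj₁ refl = cong (s ,_) (ℕ.suc-injective (step-unique s (short<n (s≤s i≤)) (short<n (s≤s j≤)) p q))
  ... | inj₂ refl = contradiction (short-opposite s (s≤s i≤) (s≤s j≤) p q) λ ()

  move-unique : ∀ {x y} a → proj₂ a ≤ M → Step′ a x y → move x a ≡ y
  move-unique {x} a le p = step-target (proj₁ a) (ℕ.<⇒≤ (short<n (s≤s le))) (step-move x a le) p

  move-disp : ∀ x y → x ≢ y → move x (disp x y) ≡ y
  move-disp x y x≢y = let st , le = step-disp x y x≢y in move-unique (disp x y) le st

  move-≢ : ∀ x a → proj₂ a ≤ M → x ≢ move x a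
  move-≢ x a le eq = contradiction
    (step-loop (proj₁ a) (short<n (s≤s le)) (subst (Step′ a x) (sym eq) (step-move x a le))) λ ()

  disp-move : ∀ x a → proj₂ a ≤ M → disp x (move x a) ≡ a
  disp-move x a le = let st , le′ = step-disp x (move x a) (move-≢ x a le) in
    letter-unique (disp x (move x a)) a le′ le st (step-move x a le)

  dist-move : ∀ x a → proj₂ a ≤ M → dist x (move x a) ≡ size a
  dist-move x a le = dist-step (proj₁ a) (s≤s le) (step-move x a le)

  ⊕-step : ∀ {x y z} s i j → Step s (suc i) x y → Step s (suc j) y z → Step s (suc (suc (i ℕ.+ j))) x z
  ⊕-step {x} {z = z} s i j p q = subst (λ r → Step s r x z) (cong suc (ℕ.+-suc i j)) (step-+ s p q)

  -- A strictly shorter route exists. Two steps of one direction with sum above m are beaten by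
  -- going round the other way, with at most m edges; opposite steps partly cancel.
  dist-detour : ∀ {x y z} s i t j → i ≤ M → j ≤ M → ¬ (s ≡ t × i ℕ.+ j < M) →
    Step s (suc i) x y → Step t (suc j) y z → dist x z ≢ suc i ℕ.+ suc j
  dist-detour {x} {y} {z} s i t j i≤ j≤ ¬m p q with same-or-not s t
  ... | inj₁ refl = λ eq → ℕ.<⇒≢ (subst (_< suc i ℕ.+ suc j) (sym d≡) (ℕ.≤-<-trans (complement-short r>) r>)) eq
    where
    r> : suc M < suc i ℕ.+ suc j
    r> = ℕ.≰⇒> λ le → ¬m (refl , ℕ.s≤s⁻¹ (subst (_≤ suc M) (cong suc (ℕ.+-suc i j)) le))
    d≡ : dist x z ≡ n ∸ (suc i ℕ.+ suc j)
    d≡ = dist-step (not s) (complement-short r>) (step-not s (ℕ.<⇒≤ (short+short<n (s≤s i≤) (s≤s j≤))) (step-+ s p q))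
  ... | inj₂ refl with ℕ.≤-total i j
  ...   | inj₁ i≤j = ℕ.<⇒≢ (ℕ.≤-<-trans (ℕ.≤-reflexive d≡) (ℕ.≤-<-trans (ℕ.m∸n≤m j i) (ℕ.m≤n+m (suc j) (suc i))))
    where
    d≡ : dist x z ≡ j ∸ i
    d≡ = dist-step (not s) (ℕ.≤-trans (ℕ.m∸n≤m j i) (ℕ.≤-trans j≤ (ℕ.n≤1+n M)))
           (step-back′ s (ℕ.<⇒≤ (short<n (s≤s j≤))) (s≤s i≤j) p q)
  ...   | inj₂ j≤i = ℕ.<⇒≢ (ℕ.≤-<-trans (ℕ.≤-reflexive d≡) (ℕ.≤-<-trans (ℕ.m∸n≤m i j) (ℕ.m≤m+n (suc i) (suc j))))
    where
    d≡ : dist x z ≡ i ∸ j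
    d≡ = dist-step s (ℕ.≤-trans (ℕ.m∸n≤m i j) (ℕ.≤-trans i≤ (ℕ.n≤1+n M)))
           (step-back s (ℕ.<⇒≤ (short<n (s≤s i≤))) (s≤s j≤i) p q)

  -- The arguments of `F` on the two sides are known to agree only when the steps merge; otherwise
  -- both coefficients vanish.
  merge-bracket : ∀ x a b → proj₂ a ≤ M → proj₂ b ≤ M → (F : V → ℤ) →
    let y = move x a; z = move y b in
    ⟦ dist x z ≡ᵇ dist x y ℕ.+ dist y z ⟧ * F z ≡ χ a b * F (move x (a ⊕ b))
  merge-bracket x a@(s , i) b@(t , j) i≤ j≤ F rewrite dist-move x a i≤ | dist-move (move x a) b j≤
    with same-or-not s t | i ℕ.+ j ℕ.<? M
  ... | inj₂ refl | _ rewrite χ-opp s i j = cong (_* F (move (move x a) b))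
        (⟦¬T⟧ {dist x (move (move x a) b) ≡ᵇ suc i ℕ.+ suc j} (λ p → dist-detour s i (not s) j i≤ j≤ (λ (eq , _) → s≢not s eq)
          (step-move x a i≤) (step-move (move x a) b j≤) (ℕ.≡ᵇ⇒≡ _ _ p)))
    where
    s≢not : ∀ s → s ≢ not s
    s≢not true  ()
    s≢not false ()
  ... | inj₁ refl | no ≮ rewrite ⟦¬T⟧ {i ℕ.+ j <ᵇ M} (λ p → ≮ (ℕ.<ᵇ⇒< _ _ p)) | ℤ.*-zeroʳ ⟦ s ≈ˢ s ⟧ =
        cong (_* F (move (move x a) b))
        (⟦¬T⟧ {dist x (move (move x a) b) ≡ᵇ suc i ℕ.+ suc j} (λ p → dist-detour s i s j i≤ j≤ (λ (_ , lt) → ≮ lt)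
          (step-move x a i≤) (step-move (move x a) b j≤) (ℕ.≡ᵇ⇒≡ _ _ p)))
  ... | inj₁ refl | yes lt = cong₂ _*_
        (trans (⟦T⟧ (ℕ.≡⇒≡ᵇ (dist x (move (move x a) b)) (suc i ℕ.+ suc j) d≡))
               (sym (χ-same s)))
        (cong F (sym (move-unique (a ⊕ b) lt st)))
    where
    st = ⊕-step s i j (step-move x a i≤) (step-move (move x a) b j≤)
    d≡ : dist x (move (move x a) b) ≡ suc i ℕ.+ suc j
    d≡ = trans (dist-step s (s≤s lt) st) (cong suc (sym (ℕ.+-suc i j)))
    χ-same : ∀ s → ⟦ s ≈ˢ s ⟧ * ⟦ i ℕ.+ j <ᵇ M ⟧ ≡ 1ℤ
    χ-same true  = cong (1ℤ *_) (⟦T⟧ (ℕ.<⇒<ᵇ lt))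
    χ-same false = cong (1ℤ *_) (⟦T⟧ (ℕ.<⇒<ᵇ lt))

  rest : ∀ {k} → V → Word k → Vec V k
  rest x []      = []
  rest x (a ∷ w) = move x a ∷ rest (move x a) w

  tuple : ∀ {k} → V → Word k → Tup k
  tuple x w = x ∷ rest x w

  letters : ∀ {k} → Tup k → Word k
  letters (x ∷ [])     = []
  letters (x ∷ y ∷ xs) = disp x y ∷ letters (y ∷ xs)

  letters-tuple : ∀ {k} x (w : Word k) → Valid w → letters (tuple x w) ≡ w
  letters-tuple x []      []        = refl
  letters-tuple x (a ∷ w) (va ∷ vw) = cong₂ _∷_ (disp-move x a va) (letters-tuple (move x a) w vw)

  len-tuple : ∀ {k} x (w : Word k) → Valid w → len (tuple x w) ≡ total w
  len-tuple x []      []        = refl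
  len-tuple x (a ∷ w) (va ∷ vw) = cong₂ ℕ._+_ (dist-move x a va) (len-tuple (move x a) w vw)

  noRep-tuple : ∀ {k} x (w : Word k) → Valid w → noRep (tuple x w) ≡ true
  noRep-tuple x []      []        = refl
  noRep-tuple x (a ∷ w) (va ∷ vw) rewrite dec-false (x Fin.≟ move x a) (move-≢ x a va) = noRep-tuple (move x a) w vw

  tuple-letters : ∀ {k} (t : Tup k) → noRep t ≡ true → tuple (head t) (letters t) ≡ t × Valid (letters t)
  tuple-letters (x ∷ [])     _  = refl , []
  tuple-letters (x ∷ y ∷ xs) nr with x Fin.≟ y
  ... | no x≢y = let eq , vw = tuple-letters (y ∷ xs) nr in
        cong (x ∷_) (trans (cong (λ z → tuple z (letters (y ∷ xs))) (move-disp x y x≢y)) eq) , proj₂ (step-disp x y x≢y) ∷ vw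

  valid-tuple : ∀ {k} x (w : Word k) → Valid w → valid k (total w) (tuple x w) ≡ true
  valid-tuple x w vw rewrite noRep-tuple x w vw | len-tuple x w vw = T⇒≡ (ℕ.≡⇒≡ᵇ (total w) (total w) refl)
    where
    T⇒≡ : ∀ {b} → True b → b ≡ true
    T⇒≡ {true} _ = refl

  valid⇒tuple : ∀ {k} l (t : Tup k) → valid k l t ≡ true → ∃ λ x → ∃ λ w → Valid w × total w ≡ l × t ≡ tuple x w
  valid⇒tuple l t v with noRep t in nr
  ... | true = let eq , vw = tuple-letters t nr in
    head t , letters t , vw ,
    trans (sym (len-tuple (head t) (letters t) vw)) (trans (cong len eq) (ℕ.≡ᵇ⇒≡ (len t) l (subst True (sym v) tt))) , sym eq

  δᶠ-tuple : ∀ {k} (f : Tup k → ℤ) x w → Valid w → δᶠ f (tuple x w) ≡ δ (λ v → f (tuple x v)) w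
  δᶠ-tuple f x (a ∷ [])    _ = refl
  δᶠ-tuple f x (a ∷ b ∷ w) (va ∷ vb ∷ vw) =
    cong₂ (λ p q → - p - q) (merge-bracket x a b va vb (λ z → f (x ∷ z ∷ rest z w)))
      (δᶠ-tuple (λ t → f (x ∷ t)) (move x a) (b ∷ w) (vb ∷ vw))

  -- Passage to chains

  _≟ᵗ_ : ∀ {k} (t u : Vec V k) → Dec (t ≡ u)
  _≟ᵗ_ = ≡-dec Fin._≟_

  allVecs-step : ∀ j → allVecs (suc j) ≡ cartesianProductWith (λ v x → x ∷ v) (allVecs j) (allFin n)
  allVecs-step j = concatMap-map (λ v x → x ∷ v) (allVecs j) (allFin n)

  allVecs-unique : ∀ j → Unique (allVecs j)
  allVecs-unique zero    = ListAll.[] AllPairs.∷ AllPairs.[]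
  allVecs-unique (suc j) = subst Unique (sym (allVecs-step j))
    (Unique.cartesianProductWith⁺ (λ v x → x ∷ v) (λ eq → ∷-injectiveʳ eq , ∷-injectiveˡ eq) (allVecs-unique j) (Unique.allFin⁺ n))

  ∈-allVecs : ∀ {j} (v : Vec V j) → v ∈ allVecs j
  ∈-allVecs []      = here refl
  ∈-allVecs (x ∷ v) = subst (x ∷ v ∈_) (sym (allVecs-step _)) (∈-cartesianProductWith⁺ (λ v x → x ∷ v) (∈-allVecs v) (∈-allFin x))

  e-sym : ∀ {k} (t u : Tup k) → e t u ≡ e u t
  e-sym t u with u ≟ᵗ t
  ... | yes refl rewrite dec-true (u ≟ᵗ u) refl = refl
  ... | no u≢t   rewrite dec-false (t ≟ᵗ u) (u≢t ∘ sym) = refl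

  e-≢ : ∀ {k} (t u : Tup k) → u ≢ t → e t u ≡ 0ℤ
  e-≢ t u u≢t rewrite dec-false (u ≟ᵗ t) u≢t = refl

  ⟨_∣_⟩ : ∀ {k} → Chain k → (Tup k → ℤ) → ℤ
  ⟨_∣_⟩ {k} c F = ∑ (allVecs (suc k)) (λ t → c t * F t)

  pairing-e : ∀ {k} (c : Chain k) u → ⟨ c ∣ e u ⟩ ≡ c u
  pairing-e {k} c u = trans (∑-cong (allVecs (suc k)) (λ t → cong (c t *_) (e-sym u t)))
    (∑-indicator _≟ᵗ_ (allVecs (suc k)) c (allVecs-unique (suc k)) (∈-allVecs u))

  e-pairing : ∀ {k} u (F : Tup k → ℤ) → ⟨ e u ∣ F ⟩ ≡ F u
  e-pairing {k} u F = trans (∑-cong (allVecs (suc k)) (λ t → ℤ.*-comm (e u t) (F t))) (pairing-e F u)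

  pairing-+ : ∀ {k} (c : Chain k) F G → ⟨ c ∣ (λ t → F t + G t) ⟩ ≡ ⟨ c ∣ F ⟩ + ⟨ c ∣ G ⟩
  pairing-+ {k} c F G = trans (∑-cong (allVecs (suc k)) (λ t → ℤ.*-distribˡ-+ (c t) (F t) (G t)))
    (∑-+ (allVecs (suc k)) (λ t → c t * F t) (λ t → c t * G t))

  pairing-0 : ∀ {k} {c : Chain k} F → (∀ t → c t ≡ 0ℤ) → ⟨ c ∣ F ⟩ ≡ 0ℤ
  pairing-0 {k} F h = ∑-0 (allVecs (suc k)) (λ t → trans (cong (_* F t) (h t)) refl)

  pairing-∑ : ∀ {k} {B : Set} (ys : List B) (a : B → ℤ) (cs : B → Chain k) F →
              ⟨ (λ t → ∑ ys (λ y → a y * cs y t)) ∣ F ⟩ ≡ ∑ ys (λ y → a y * ⟨ cs y ∣ F ⟩)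
  pairing-∑ {k} ys a cs F =
    trans (∑-cong ts (λ t → trans (ℤ.*-comm _ (F t)) (trans (sym (∑-*ˡ ys (F t) (λ y → a y * cs y t)))
             (∑-cong ys (λ y → lem (F t) (a y) (cs y t))))))
    (trans (∑-swap ts ys (λ t y → a y * (cs y t * F t)))
      (∑-cong ys (λ y → ∑-*ˡ ts (a y) (λ t → cs y t * F t))))
    where
    ts = allVecs (suc k)
    lem : ∀ f a c → f * (a * c) ≡ a * (c * f)
    lem = solve-∀

  pairing-* : ∀ {k} a (c : Chain k) F → ⟨ (λ t → a * c t) ∣ F ⟩ ≡ a * ⟨ c ∣ F ⟩
  pairing-* {k} a c F = trans (∑-cong (allVecs (suc k)) (λ t → ℤ.*-assoc a (c t) (F t))) (∑-*ˡ (allVecs (suc k)) a (λ t → c t * F t))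

  pairing-local : ∀ {k l} {c : Chain k} → InMC k l c → ∀ F G →
    (∀ x w → Valid w → total w ≡ l → F (tuple x w) ≡ G (tuple x w)) → ⟨ c ∣ F ⟩ ≡ ⟨ c ∣ G ⟩
  pairing-local {k} {l} {c} cIn F G h = ∑-cong (allVecs (suc k)) agree
    where
    agree : ∀ t → c t * F t ≡ c t * G t
    agree t with valid k l t in eq
    ... | false rewrite cIn t eq = refl
    ... | true with valid⇒tuple l t eq
    ...   | x , w , vw , tw , refl = cong (c (tuple x w) *_) (h x w vw tw)

  -- Expand `G` in the indicators `e v` of the finitely many tuples. A cochain operator is thereby
  -- transposed to a chain operator, reversing compositions.
  adjoint : ∀ {j k} (Ψ : (Tup j → ℤ) → Tup k → ℤ) → (∀ t → Linear (λ f → Ψ f t)) →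
            ∀ c G → ⟨ (λ v → ⟨ c ∣ Ψ (e v) ⟩) ∣ G ⟩ ≡ ⟨ c ∣ Ψ G ⟩
  adjoint {j} {k} Ψ lin c G =
    trans (∑-cong vs (λ v → trans (ℤ.*-comm ⟨ c ∣ Ψ (e v) ⟩ (G v)) (sym (∑-*ˡ ts (G v) (λ t → c t * Ψ (e v) t)))))
    (trans (∑-swap vs ts (λ v t → G v * (c t * Ψ (e v) t)))
    (∑-cong ts λ t → trans (∑-cong vs (λ v → lem (G v) (c t) (Ψ (e v) t)))
      (trans (∑-*ˡ vs (c t) (λ v → G v * Ψ (e v) t)) (cong (c t *_) (expand t)))))
    where
    vs = allVecs (suc j)
    ts = allVecs (suc k)
    lem : ∀ g c p → g * (c * p) ≡ c * (g * p)
    lem = solve-∀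
    expand : ∀ t → ∑ vs (λ v → G v * Ψ (e v) t) ≡ Ψ G t
    expand t = trans (sym (Linear.∑-image (lin t) vs G e))
      (Linear.congruent (lin t) (λ u → ∑-indicator _≟ᵗ_ vs G (allVecs-unique (suc j)) (∈-allVecs u)))

  -- No face omits the first vertex, so it is a mere parameter; this is the splitting into 2m + 1
  -- copies.
  lift : ∀ {j k} → (Cochain j → Cochain k) → (Tup j → ℤ) → Tup k → ℤ
  lift Op f t = Op (λ w → f (tuple (head t) w)) (letters t)

  lift-tuple : ∀ {j k} (Op : Cochain j → Cochain k) f x w → Valid w → lift Op f (tuple x w) ≡ Op (λ v → f (tuple x v)) w
  lift-tuple Op f x w vw = cong (Op (λ v → f (tuple x v))) (letters-tuple x w vw)

  lift-linear : ∀ {j k} (Op : Cochain j → Cochain k) → (∀ w → Linear (λ f → Op f w)) → ∀ t → Linear (λ f → lift Op f t)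
  lift-linear Op lin t = record
    { congruent = λ h → Linear.congruent (lin (letters t)) (λ w → h (tuple (head t) w))
    ; linear    = λ a b f g → Linear.linear (lin (letters t)) a b (λ w → f (tuple (head t) w)) (λ w → g (tuple (head t) w))
    }

  δᵗ : ∀ {k} → (Tup k → ℤ) → Tup (suc k) → ℤ
  δᵗ = lift δ
  Hᵗ : ∀ {k} → (Tup (suc k) → ℤ) → Tup k → ℤ
  Hᵗ = lift H
  Πᵗ : ∀ {k} → (Tup k → ℤ) → Tup k → ℤ
  Πᵗ = lift Π

  δ-isLinear : ∀ {k} w → Linear (λ f → δ {k} f w)
  δ-isLinear w = record { congruent = δ-cong w ; linear = λ a b f g → δ-linear a b f g w }

  H-isLinear : ∀ {k} w → Linear (λ f → H {k} f w)
  H-isLinear w = record { congruent = H-cong w ; linear = λ a b f g → H-linear a b f g w }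

  ∂-pairing : ∀ {k l c} → InMC (suc k) l c → ∀ y → ∂ k c y ≡ ⟨ c ∣ δᵗ (e y) ⟩
  ∂-pairing {k} cIn y = pairing-local cIn (λ x → ∂coeff k x y) (δᵗ (e y)) λ x w vw _ →
    trans (∂coeff≡ k (tuple x w) y) (trans (δᶠ-tuple (e y) x w vw) (sym (lift-tuple δ (e y) x w vw)))

  ∂-adjoint : ∀ {k l c} → InMC (suc k) l c → ∀ G → ⟨ ∂ k c ∣ G ⟩ ≡ ⟨ c ∣ δᵗ G ⟩
  ∂-adjoint {k} {c = c} cIn G = trans (∑-cong (allVecs (suc k)) (λ y → cong (_* G y) (∂-pairing cIn y)))
    (adjoint δᵗ (lift-linear δ δ-isLinear) c G)

  h : ∀ {k} → Chain k → Chain (suc k)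
  h c v = ⟨ c ∣ Hᵗ (e v) ⟩

  valid-tuple-≢ : ∀ {k l} {t : Tup k} → valid k l t ≡ false → ∀ x w → Valid w → total w ≡ l → tuple x w ≢ t
  valid-tuple-≢ inv x w vw refl refl = contradiction (trans (sym (valid-tuple x w vw)) inv) λ ()

  pairing-vanish : ∀ {k l} {c : Chain k} → InMC k l c → ∀ F →
    (∀ x w → Valid w → total w ≡ l → F (tuple x w) ≡ 0ℤ) → ⟨ c ∣ F ⟩ ≡ 0ℤ
  pairing-vanish {k} {c = c} cIn F h = trans (pairing-local cIn F (λ _ → 0ℤ) h) (∑-0 (allVecs (suc k)) (λ t → ℤ.*-zeroʳ (c t)))

  h-InMC : ∀ {k l c} → InMC k l c → InMC (suc k) l (h c)
  h-InMC cIn v inv = pairing-vanish cIn (Hᵗ (e v)) λ x w vw tw →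
    trans (lift-tuple H (e v) x w vw)
    (trans (H-local w vw (λ w′ vw′ tw′ _ → e-≢ v (tuple x w′) (valid-tuple-≢ inv x w′ vw′ (trans tw′ tw))))
           (Linear.zero-image (H-isLinear w)))

  ∂h : ∀ {k l c} → InMC k l c → ∀ u → ∂ k (h c) u ≡ ⟨ c ∣ Hᵗ (δᵗ (e u)) ⟩
  ∂h {c = c} cIn u = trans (∂-pairing (h-InMC cIn) u) (adjoint Hᵗ (lift-linear H H-isLinear) c (δᵗ (e u)))

  pr : ∀ {k} → Chain k → Tup k → ℤ
  pr c u = ⟨ c ∣ Πᵗ (e u) ⟩

  Hδ-tuple : ∀ {k} (f : Tup k → ℤ) x w → Valid w → Hᵗ (δᵗ f) (tuple x w) ≡ H (δ (λ v → f (tuple x v))) w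
  Hδ-tuple f x w vw = trans (lift-tuple H (δᵗ f) x w vw) (H-local w vw (λ v vv _ _ → lift-tuple δ f x v vv))

  δH-tuple : ∀ {k} (f : Tup (suc k) → ℤ) x w → Valid w → δᵗ (Hᵗ f) (tuple x w) ≡ δ (H (λ v → f (tuple x v))) w
  δH-tuple f x w vw = trans (lift-tuple δ (Hᵗ f) x w vw) (δ-local w vw (λ v vv → lift-tuple H f x v vv))

  δΠ-tuple : ∀ {k} (f : Tup k → ℤ) x w → Valid w → δᵗ (Πᵗ f) (tuple x w) ≡ 0ℤ
  δΠ-tuple f x w vw = trans (lift-tuple δ (Πᵗ f) x w vw)
    (trans (δ-local w vw (λ v vv → lift-tuple Π f x v vv)) (δΠ (λ v → f (tuple x v)) w))

  cycle-InMC : ∀ k {l c} → Cycle k l c → InMC k l c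
  cycle-InMC zero    cy = cy
  cycle-InMC (suc k) cy = proj₁ cy

  -- Pair `c` with the contraction identity for `e u`: the term `H δ` is transposed to `∂ h`, and
  -- `δ H` becomes a pairing with the boundary of `c`, which is zero.
  cycle-reduce : ∀ k {l c} → Cycle k l c → ∀ u → c u ≡ pr c u + ∂ k (h c) u
  cycle-reduce zero {c = c} cy u = begin
    c u                                                ≡⟨ pairing-e c u ⟨
    ⟨ c ∣ e u ⟩
      ≡⟨ pairing-local cy (e u) (λ t → Πᵗ (e u) t + Hᵗ (δᵗ (e u)) t) (λ x w vw _ →
         trans (contraction₀ (λ v → e u (tuple x v)) w)
               (sym (cong₂ _+_ (lift-tuple Π (e u) x w vw) (Hδ-tuple (e u) x w vw)))) ⟩
    ⟨ c ∣ (λ t → Πᵗ (e u) t + Hᵗ (δᵗ (e u)) t) ⟩       ≡⟨ pairing-+ c (Πᵗ (e u)) (Hᵗ (δᵗ (e u))) ⟩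
    pr c u + ⟨ c ∣ Hᵗ (δᵗ (e u)) ⟩                     ≡⟨ cong (pr c u +_) (sym (∂h cy u)) ⟩
    pr c u + ∂ zero (h c) u                            ∎
    where open ≡-Reasoning
  cycle-reduce (suc k) {c = c} (cIn , ∂c≡0) u = begin
    c u                                                ≡⟨ pairing-e c u ⟨
    ⟨ c ∣ e u ⟩
      ≡⟨ pairing-local cIn (e u) (λ t → Πᵗ (e u) t + Hᵗ (δᵗ (e u)) t + δᵗ (Hᵗ (e u)) t) (λ x w vw _ →
         trans (contraction (λ v → e u (tuple x v)) w vw)
               (sym (cong₂ _+_ (cong₂ _+_ (lift-tuple Π (e u) x w vw) (Hδ-tuple (e u) x w vw)) (δH-tuple (e u) x w vw)))) ⟩
    ⟨ c ∣ (λ t → Πᵗ (e u) t + Hᵗ (δᵗ (e u)) t + δᵗ (Hᵗ (e u)) t) ⟩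
      ≡⟨ trans (pairing-+ c (λ t → Πᵗ (e u) t + Hᵗ (δᵗ (e u)) t) (δᵗ (Hᵗ (e u))))
               (cong (_+ ⟨ c ∣ δᵗ (Hᵗ (e u)) ⟩) (pairing-+ c (Πᵗ (e u)) (Hᵗ (δᵗ (e u))))) ⟩
    pr c u + ⟨ c ∣ Hᵗ (δᵗ (e u)) ⟩ + ⟨ c ∣ δᵗ (Hᵗ (e u)) ⟩
      ≡⟨ cong₂ (λ p q → pr c u + p + q) (sym (∂h cIn u)) (trans (sym (∂-adjoint cIn (Hᵗ (e u)))) (pairing-0 (Hᵗ (e u)) ∂c≡0)) ⟩
    pr c u + ∂ (suc k) (h c) u + 0ℤ                    ≡⟨ ℤ.+-identityʳ _ ⟩
    pr c u + ∂ (suc k) (h c) u                         ∎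
    where open ≡-Reasoning

  -- The transpose of `δΠ`.
  pr-boundary : ∀ {k l c} → Boundary k l c → ∀ u → pr c u ≡ 0ℤ
  pr-boundary {k} {c = c} (b , bIn , ∂b≡c) u =
    trans (∑-cong (allVecs (suc k)) (λ t → cong (_* Πᵗ (e u) t) (sym (∂b≡c t))))
    (trans (∂-adjoint bIn (Πᵗ (e u))) (pairing-vanish bIn (δᵗ (Πᵗ (e u))) (λ x w vw _ → δΠ-tuple (e u) x w vw)))

  pr≡0⇒boundary : ∀ {k l c} → Cycle k l c → (∀ u → pr c u ≡ 0ℤ) → Boundary k l c
  pr≡0⇒boundary {k} {c = c} cy pr≡0 = h c , h-InMC (cycle-InMC k cy) , λ u →
    sym (trans (cycle-reduce k cy u) (trans (cong (_+ ∂ k (h c) u) (pr≡0 u)) (ℤ.+-identityˡ _)))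

  -- Torsion-freeness and rank

  torsionFree : ∀ k l → TorsionFree k l
  torsionFree k l z cy a a≢0 bd = pr≡0⇒boundary cy λ u → cancel (trans (sym (pairing-* a z (Πᵗ (e u)))) (pr-boundary bd u))
    where
    cancel : ∀ {p} → a * p ≡ 0ℤ → p ≡ 0ℤ
    cancel eq with ℤ.i*j≡0⇒i≡0∨j≡0 a eq
    ... | inj₁ a≡0 = contradiction a≡0 a≢0
    ... | inj₂ p≡0 = p≡0

  crits : ∀ k l → List (Tup k)
  crits k l = cartesianProductWith tuple (allFin n) (fresh k l)

  length-crits : ∀ k l → length (crits k l) ≡ T (suc M) k l
  length-crits k l = trans (length-cartesianProductWith tuple (allFin n) (fresh k l))
    (trans (cong (ℕ._* length (fresh k l)) (length-tabulate {n = n} (λ i → i))) (length-T k l))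

  crits-sound : ∀ k l {t} → t ∈ crits k l → ∃ λ x → ∃ λ w → Crit w × total w ≡ l × t ≡ tuple x w
  crits-sound k l t∈ with ∈-cartesianProductWith⁻ tuple (allFin n) (fresh k l) t∈
  ... | x , w , _ , w∈ , refl = let c , tw = fresh-sound k l w∈ in x , w , c , tw , refl

  crits-unique : ∀ k l → Unique (crits k l)
  crits-unique k l = unique (Unique.allFin⁺ n)
    where
    ws = fresh k l
    tuple-injective : ∀ {x w w′} → Crit w → Crit w′ → tuple x w ≡ tuple x w′ → w ≡ w′
    tuple-injective {x} {w} {w′} c c′ eq = trans (sym (letters-tuple x w (crit-valid c)))
      (trans (cong letters eq) (letters-tuple x w′ (crit-valid c′)))
    -- `tuple x` is injective on valid words only, since `move` sees sizes modulo n; so criticality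
    -- of the listed words is carried along.
    map-unique : ∀ x {ws} → (∀ {w} → w ∈ ws → Crit w) → Unique ws → Unique (map (tuple x) ws)
    map-unique x cs AllPairs.[] = AllPairs.[]
    map-unique x {w ∷ ws} cs (w∉ AllPairs.∷ u) = ∉ ws (cs ∘ there) w∉ AllPairs.∷ map-unique x (cs ∘ there) u
      where
      ∉ : ∀ ws → (∀ {w} → w ∈ ws → Crit w) → ListAll.All (w ≢_) ws → ListAll.All (tuple x w ≢_) (map (tuple x) ws)
      ∉ []        _   ListAll.[]       = ListAll.[]
      ∉ (w′ ∷ ws) cs′ (≢ ListAll.∷ ≢s) = (≢ ∘ tuple-injective (cs (here refl)) (cs′ (here refl))) ListAll.∷ ∉ ws (cs′ ∘ there) ≢s
    disjoint : ∀ {x xs t} → ListAll.All (x ≢_) xs → ∃ (λ w → w ∈ ws × t ≡ tuple x w) →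
               ∃ (λ y → ∃ λ w → y ∈ xs × w ∈ ws × t ≡ tuple y w) → ⊥
    disjoint x∉ (_ , _ , refl) (_ , _ , y∈ , _ , eq) = ListAll.lookup x∉ y∈ (∷-injectiveˡ eq)
    unique : ∀ {xs} → Unique xs → Unique (cartesianProductWith tuple xs ws)
    unique AllPairs.[] = AllPairs.[]
    unique {x ∷ xs} (x∉ AllPairs.∷ u) =
      Unique.++⁺ (map-unique x (proj₁ ∘ fresh-sound k l) (fresh-unique k l)) (unique u)
        λ (p , q) → disjoint x∉ (∈-map⁻ (tuple x) p) (∈-cartesianProductWith⁻ tuple xs ws q)

  not-crit : ∀ {k l} {u : Tup k} → ¬ (u ∈ crits k l) → ∀ x w → Valid w → total w ≡ l → Πᵗ (e u) (tuple x w) ≡ 0ℤ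
  not-crit {k} {l} {u} u∉ x w vw tw = trans (lift-tuple Π (e u) x w vw)
    (trans (Π-local w (λ v cv tv _ → e-≢ u (tuple x v) λ { refl →
              u∉ (∈-cartesianProductWith⁺ tuple (∈-allFin x) (fresh-complete l cv (trans tv tw))) }))
           (Π-zero w))
    where
    Π-zero : ∀ {k} (w : Word k) → Π (λ _ → 0ℤ) w ≡ 0ℤ
    Π-zero w = Π-linear 0ℤ 0ℤ (λ _ → 0ℤ) (λ _ → 0ℤ) w

  pr-crits : ∀ {k l c} → InMC k l c → (∀ i → pr c (List.lookup (crits k l) i) ≡ 0ℤ) → ∀ u → pr c u ≡ 0ℤ
  pr-crits {k} {l} {c} cIn pr≡0 u with any? (u ≟ᵗ_) (crits k l)
  ... | yes u∈ = subst (λ t → pr c t ≡ 0ℤ) (sym (lookup-index u∈)) (pr≡0 (index u∈))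
  ... | no  u∉ = pairing-vanish cIn (Πᵗ (e u)) (not-crit u∉)

  crit-cycle : ∀ k {l t} → t ∈ crits k l → Cycle k l (e t)
  crit-cycle k {l} t∈ with crits-sound k l t∈
  ... | x , w , cw , refl , refl = cyc k w cw
    where
    inMC : ∀ {k} w → Crit w → InMC k (total w) (e (tuple x w))
    inMC w cw u inv = e-≢ (tuple x w) u (valid-tuple-≢ inv x w (crit-valid cw) refl ∘ sym)
    cyc : ∀ k w → Crit w → Cycle k (total w) (e (tuple x w))
    cyc zero    w cw = inMC w cw
    cyc (suc k) w cw = inMC w cw , λ y →
      trans (∂-pairing (inMC w cw) y) (trans (e-pairing (tuple x w) (δᵗ (e y)))
        (trans (lift-tuple δ (e y) x w (crit-valid cw)) (δ-crit (λ v → e y (tuple x v)) cw)))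

  pr-crit : ∀ {k l t} → t ∈ crits k l → ∀ u → pr (e t) u ≡ e u t
  pr-crit {k} {l} {t} t∈ u with crits-sound k l t∈
  ... | x , w , cw , refl , refl = trans (e-pairing (tuple x w) (Πᵗ (e u)))
    (trans (lift-tuple Π (e u) x w (crit-valid cw)) (Π-crit (λ v → e u (tuple x v)) cw))

  -- `pr` fixes critical tuples, so the value of `pr` of a combination at the j-th one is its j-th
  -- coefficient; on a boundary that value is zero.
  crits-independent : ∀ k l → Independent k l (length (crits k l)) (λ i → e (List.lookup (crits k l) i))
  crits-independent k l = (λ i → crit-cycle k (∈-lookup i)) , λ a bd j → begin
    a j
      ≡⟨ ∑-indicator Fin._≟_ (allFin r) a (Unique.allFin⁺ r) (∈-allFin j) ⟨
    ∑ (allFin r) (λ i → a i * ⟦ does (j Fin.≟ i) ⟧)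
      ≡⟨ ∑-cong (allFin r) (λ i → cong (a i *_) (trans (same i j) (sym (pr-crit {k} {l} (∈-lookup i) (t j))))) ⟩
    ∑ (allFin r) (λ i → a i * pr (e (t i)) (t j))
      ≡⟨ pairing-∑ (allFin r) a (λ i → e (t i)) (Πᵗ (e (t j))) ⟨
    pr (λ x → ∑ (allFin r) (λ i → a i * e (t i) x)) (t j)
      ≡⟨ pr-boundary bd (t j) ⟩
    0ℤ ∎
    where
    open ≡-Reasoning
    r = length (crits k l)
    t = List.lookup (crits k l)
    same : ∀ i j → ⟦ does (j Fin.≟ i) ⟧ ≡ e (t j) (t i)
    same i j with j Fin.≟ i
    ... | yes refl rewrite dec-true (t j ≟ᵗ t j) refl = refl
    ... | no j≢i = sym (e-≢ (t j) (t i) (λ eq → j≢i (sym (lookup-unique (crits-unique k l) i j eq))))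

  combination-cycle : ∀ k {l} {B : Set} (ys : List B) (a : B → ℤ) (zs : B → Chain k) → (∀ y → Cycle k l (zs y)) →
                      Cycle k l (λ x → ∑ ys (λ y → a y * zs y x))
  combination-cycle k {l} {B} ys a zs cy = cyc k zs cy
    where
    inMC : ∀ {k l} (zs : B → Chain k) → (∀ y → InMC k l (zs y)) → InMC k l (λ x → ∑ ys (λ y → a y * zs y x))
    inMC zs zsIn x inv = ∑-0 ys (λ y → trans (cong (a y *_) (zsIn y x inv)) (ℤ.*-zeroʳ (a y)))
    cyc : ∀ k {l} (zs : B → Chain k) → (∀ y → Cycle k l (zs y)) → Cycle k l (λ x → ∑ ys (λ y → a y * zs y x))
    cyc zero    zs cy = inMC zs cy
    cyc (suc k) zs cy = inMC zs (proj₁ ∘ cy) , λ x →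
      trans (pairing-∑ ys a zs (λ t → ∂coeff k t x)) (∑-0 ys (λ y → trans (cong (a y *_) (proj₂ (cy y) x)) (ℤ.*-zeroʳ (a y))))

  -- The values of `pr` at the r critical tuples give r + 1 rows of length r, hence an integer
  -- relation. The corresponding combination of cycles has vanishing `pr` and therefore bounds.
  crits-maximal : ∀ k l → ¬ (∃ λ zs → Independent k l (suc (length (crits k l))) zs)
  crits-maximal k l (zs , cy , ind) with dependent (length (crits k l)) (λ j i → pr (zs j) (List.lookup (crits k l) i))
  ... | a , (j , aj≢0) , rel = aj≢0 (ind a (pr≡0⇒boundary cz (pr-crits (cycle-InMC k cz) λ i →
          trans (pairing-∑ (allFin _) a zs (Πᵗ (e (List.lookup (crits k l) i)))) (rel i))) j)
    where
    cz = combination-cycle k (allFin (suc (length (crits k l)))) a zs cy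

  hasRank : ∀ k l → HasRank k l (T (suc M) k l)
  hasRank k l = subst (HasRank k l) (length-crits k l) ((_ , crits-independent k l) , crits-maximal k l)

open import Data.Nat using (_*_; _+_)

theorem4p6 : ∀ (m : ℕ) → 2 ≤ m →
    (∀ (k l : ℕ) → Graph.TorsionFree (2 * m + 1) (cycleAdj (2 * m + 1)) k l) ×
    (∀ (k l : ℕ) → Graph.HasRank (2 * m + 1) (cycleAdj (2 * m + 1)) k l (T m k l))
theorem4p6 (suc M) _ = OddCycle.torsionFree M , OddCycle.hasRank M
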